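{- For every $n>3$ and every Steiner triple system $S$ on $n$ vertices, $$\mathrm{mc}_3(S)\leq n-\alpha_3^*(S)\leq n-\frac{0.417}{3}\sqrt{n\log n}.$$
   Context: A Steiner triple system is a $3$-uniform hypergraph in which each pair of distinct vertices is contained in exactly one edge. Here $\log$ is the natural logarithm. The shadow-graph $H^{(2)}$ of a hypergraph $H$ is the graph on $V(H)$ in which $\{x,y\}$ is an edge if and only if some $e\in E(H)$ satisfies $\{x,y\}\subseteq e$. $H$ is connected if $H^{(2)}$ is connected, and the components of $H$ are its maximal connected subgraphs (so an isolated vertex is a component on one vertex). An $r$-coloring of $H$ is a partition $\{E_1,\dots,E_r\}$ of $E(H)$ in which some of the sets may be empty. A monochromatic component of $H$ (with respect to this coloring) is a component of the hypergraph $(V(H),E_i)$ for some $i\in\{1,\dots,r\}$. $\mathrm{mc}_r(H)$ is the largest integer $m$ such that in every $r$-coloring of the edges of $H$ there is a monochromatic component on at least $m$ vertices. $\alpha_3^*(H)$ is the maximum integer $a$ such that there exist pairwise disjoint sets $X_1,X_2,X_3\subseteq V(H)$ with $|X_1|=|X_2|=|X_3|=a$ such that for every $e\in E(H)$ there is $i\in\{1,2,3\}$ with $e\cap X_i=\emptyset$. -}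

module Defs where

open import Data.Bool using (if_then_else_)
open import Data.Fin using (Fin; zero; suc)
import Data.Fin.Properties as Fin
open import Data.Fin.Subset
  using (Subset; inside; outside; _∈_; _⊆_; _∩_; ⊤; Empty; Nonempty)
  renaming (∣_∣ to card)
open import Data.Fin.Subset.Properties
  using (_∈?_; _⊆?_; nonempty?; anySubset?; ∈⊤)
open import Data.Integer using (+_)
import Data.Integer as ℤ
import Data.Integer.Properties as ℤ
open import Data.Nat using (ℕ; zero; suc)
import Data.Nat as ℕ
import Data.Nat.Properties as ℕ
open import Data.Product using (Σ; _×_; _,_; proj₁; proj₂; ∃; ∃-syntax; ∃!)
open import Data.Rational using (ℚ; 0ℚ; 1ℚ; ½; _/_)
import Data.Rational as ℚ
import Data.Rational.Properties as ℚ
open import Data.Rational.Solver using (module +-*-Solver)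
import Data.Rational.Unnormalised as ℚᵘ
import Data.Rational.Unnormalised.Properties as ℚᵘ
open import Data.Sum using (_⊎_; inj₁; inj₂)
open import Data.Vec using (Vec; []; _∷_; lookup; tabulate)
open import Function using (_∘_; case_of_)
open import Relation.Binary.Construct.Closure.ReflexiveTransitive
  using (Star; ε; _◅_; _◅◅_)
open import Relation.Binary.PropositionalEquality
  using (_≡_; _≢_; refl; sym; trans; cong; cong₂; subst; subst₂)
open import Relation.Nullary using (¬_; Dec; yes; no; does; contradiction; recompute)
open import Relation.Nullary.Decidable
  using (map′; ¬?; _×-dec_; _⊎-dec_; _→-dec_; decidable-stable)
open import Relation.Unary using (Decidable)

-- The largest m ≤ b satisfying P, and 0 if there is none.
greatest : {P : ℕ → Set} → Decidable P → ℕ → ℕ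
greatest P? zero    = zero
greatest P? (suc b) = if does (P? (suc b)) then suc b else greatest P? b

greatest-upper : {P : ℕ → Set} (P? : Decidable P) {k b : ℕ} →
                 k ℕ.≤ b → P k → k ℕ.≤ greatest P? b
greatest-upper P? {k} {zero} k≤b _ = k≤b
greatest-upper P? {k} {suc b} k≤b p with P? (suc b)
... | yes _ = k≤b
... | no ¬p with ℕ.m≤n⇒m<n∨m≡n k≤b
...   | inj₁ k<b  = greatest-upper P? (ℕ.s≤s⁻¹ k<b) p
...   | inj₂ refl = contradiction p ¬p

greatest-satisfies : {P : ℕ → Set} (P? : Decidable P) (b : ℕ) →
                     P 0 → P (greatest P? b)
greatest-satisfies P? zero    p0 = p0
greatest-satisfies P? (suc b) p0 with P? (suc b)
... | yes p = p
... | no  _ = greatest-satisfies P? b p0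

------------------------------------------------------------------------
-- Real numbers: Cauchy sequences of rationals

-- m and n play symmetric roles, so the inequality bounds ∣xₘ - xₙ∣ by δ.
CauchyAt : (ℕ → ℚ) → ℚ → Set
CauchyAt x δ = ∃[ N ] (∀ m n → N ℕ.≤ m → N ℕ.≤ n → x m ℚ.≤ x n ℚ.+ δ)

Cauchy : (ℕ → ℚ) → Set
Cauchy x = ∀ δ → 0ℚ ℚ.< δ → CauchyAt x δ

record ℝ : Set where
  constructor mkℝ
  field
    approx   : ℕ → ℚ
    isCauchy : Cauchy approx

open ℝ public

infix 4 _≤ᴿ_
_≤ᴿ_ : ℝ → ℝ → Set
x ≤ᴿ y = ∀ δ → 0ℚ ℚ.< δ →
  ∃[ N ] (∀ n → N ℕ.≤ n → approx x n ℚ.≤ approx y n ℚ.+ δ)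

fromℚ : ℚ → ℝ
fromℚ q = mkℝ (λ _ → q) λ δ δ>0 → 0 , λ _ _ _ _ →
  subst (ℚ._≤ q ℚ.+ δ) (ℚ.+-identityʳ q) (ℚ.+-monoʳ-≤ q (ℚ.<⇒≤ δ>0))

fromℕ : ℕ → ℝ
fromℕ n = fromℚ (+ n / 1)

open +-*-Solver using (solve; _:=_; _:+_; _:*_; :-_; con)
open ℚ.≤-Reasoning

half>0 : ∀ {δ} → 0ℚ ℚ.< δ → 0ℚ ℚ.< ½ ℚ.* δ
half>0 {δ} δ>0 = subst (ℚ._< ½ ℚ.* δ) (ℚ.*-zeroʳ ½) (ℚ.*-monoʳ-<-pos ½ δ>0)

halves : ∀ δ → ½ ℚ.* δ ℚ.+ ½ ℚ.* δ ≡ δ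
halves = solve 1 (λ d → con ½ :* d :+ con ½ :* d := d) refl

p≤∣p∣ : ∀ p → p ℚ.≤ ℚ.∣ p ∣
p≤∣p∣ p with ℚ.≤-total 0ℚ p
... | inj₁ 0≤p = ℚ.≤-reflexive (sym (ℚ.0≤p⇒∣p∣≡p 0≤p))
... | inj₂ p≤0 = ℚ.≤-trans p≤0 (ℚ.0≤∣p∣ p)

shift : ∀ {p q δ} → p ℚ.≤ q ℚ.+ δ → p ℚ.- q ℚ.≤ δ
shift {p} {q} {δ} h = begin
  p ℚ.- q           ≤⟨ ℚ.+-monoˡ-≤ (ℚ.- q) h ⟩
  q ℚ.+ δ ℚ.- q     ≡⟨ solve 2 (λ q d → q :+ d :+ :- q := d) refl q δ ⟩
  δ                 ∎

∣-∣≤ : ∀ {p q δ} → p ℚ.≤ q ℚ.+ δ → q ℚ.≤ p ℚ.+ δ → ℚ.∣ p ℚ.- q ∣ ℚ.≤ δ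
∣-∣≤ {p} {q} {δ} h k with ℚ.∣p∣≡p∨∣p∣≡-p (p ℚ.- q)
... | inj₁ e = subst (ℚ._≤ δ) (sym e) (shift h)
... | inj₂ e = subst (ℚ._≤ δ)
  (trans (solve 2 (λ p q → q :+ :- p := :- (p :+ :- q)) refl p q) (sym e))
  (shift k)

cauchy-+ : ∀ {x y} → Cauchy x → Cauchy y → Cauchy (λ n → x n ℚ.+ y n)
cauchy-+ {x} {y} cx cy δ δ>0
  with cx (½ ℚ.* δ) (half>0 δ>0) | cy (½ ℚ.* δ) (half>0 δ>0)
... | N , hx | M , hy = N ℕ.⊔ M , λ m n Nm Nn → begin
  x m ℚ.+ y m
    ≤⟨ ℚ.+-mono-≤
         (hx m n (ℕ.m⊔n≤o⇒m≤o N M Nm) (ℕ.m⊔n≤o⇒m≤o N M Nn))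
         (hy m n (ℕ.m⊔n≤o⇒n≤o N M Nm) (ℕ.m⊔n≤o⇒n≤o N M Nn)) ⟩
  (x n ℚ.+ ½ ℚ.* δ) ℚ.+ (y n ℚ.+ ½ ℚ.* δ)
    ≡⟨ solve 3 (λ a b d → (a :+ con ½ :* d) :+ (b :+ con ½ :* d)
                        := a :+ b :+ d) refl (x n) (y n) δ ⟩
  x n ℚ.+ y n ℚ.+ δ ∎

cauchy-neg : ∀ {x} → Cauchy x → Cauchy (λ n → ℚ.- x n)
cauchy-neg {x} cx δ δ>0 with cx δ δ>0
... | N , h = N , λ m n Nm Nn → begin
  ℚ.- x m
    ≡⟨ solve 3 (λ a b d → :- a := (:- a :+ :- b) :+ b) refl (x m) (x n) δ ⟩
  (ℚ.- x m ℚ.+ ℚ.- x n) ℚ.+ x n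
    ≤⟨ ℚ.+-monoʳ-≤ (ℚ.- x m ℚ.+ ℚ.- x n) (h n m Nn Nm) ⟩
  (ℚ.- x m ℚ.+ ℚ.- x n) ℚ.+ (x m ℚ.+ δ)
    ≡⟨ solve 3 (λ a b d → (:- a :+ :- b) :+ (a :+ d) := :- b :+ d)
         refl (x m) (x n) δ ⟩
  ℚ.- x n ℚ.+ δ ∎

Bounded : (ℕ → ℚ) → Set
Bounded x = ∃[ B ] (0ℚ ℚ.< B × ∃[ N ] (∀ n → N ℕ.≤ n → ℚ.∣ x n ∣ ℚ.≤ B))

bounded : ∀ {x} → Cauchy x → Bounded x
bounded {x} cx with cx 1ℚ (ℚ.positive⁻¹ 1ℚ)
... | N , h =
  ℚ.∣ x N ∣ ℚ.+ 1ℚ ,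
  (begin-strict
    0ℚ                ≤⟨ ℚ.0≤∣p∣ (x N) ⟩
    ℚ.∣ x N ∣         ≡⟨ ℚ.+-identityʳ _ ⟨
    ℚ.∣ x N ∣ ℚ.+ 0ℚ  <⟨ ℚ.+-monoʳ-< ℚ.∣ x N ∣ (ℚ.positive⁻¹ 1ℚ) ⟩
    ℚ.∣ x N ∣ ℚ.+ 1ℚ  ∎) ,
  N , λ n Nn → begin
    ℚ.∣ x n ∣
      ≡⟨ cong ℚ.∣_∣ (solve 2 (λ a b → a := b :+ (a :+ :- b)) refl (x n) (x N)) ⟩
    ℚ.∣ x N ℚ.+ (x n ℚ.- x N) ∣
      ≤⟨ ℚ.∣p+q∣≤∣p∣+∣q∣ (x N) (x n ℚ.- x N) ⟩
    ℚ.∣ x N ∣ ℚ.+ ℚ.∣ x n ℚ.- x N ∣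
      ≤⟨ ℚ.+-monoʳ-≤ ℚ.∣ x N ∣
           (∣-∣≤ (h n N Nn ℕ.≤-refl) (h N n ℕ.≤-refl Nn)) ⟩
    ℚ.∣ x N ∣ ℚ.+ 1ℚ ∎

*-bound : ∀ p q {B δ} → ℚ.∣ p ∣ ℚ.≤ B → ℚ.∣ q ∣ ℚ.≤ δ → p ℚ.* q ℚ.≤ B ℚ.* δ
*-bound p q {B} {δ} hp hq = begin
  p ℚ.* q               ≤⟨ p≤∣p∣ _ ⟩
  ℚ.∣ p ℚ.* q ∣         ≡⟨ ℚ.∣p*q∣≡∣p∣*∣q∣ p q ⟩
  ℚ.∣ p ∣ ℚ.* ℚ.∣ q ∣   ≤⟨ ℚ.*-monoʳ-≤-nonNeg ℚ.∣ q ∣ {{ℚ.∣-∣-nonNeg q}} hp ⟩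
  B ℚ.* ℚ.∣ q ∣         ≤⟨ ℚ.*-monoˡ-≤-nonNeg B
                             {{ℚ.nonNegative (ℚ.≤-trans (ℚ.0≤∣p∣ p) hp)}} hq ⟩
  B ℚ.* δ               ∎

scaled : ∀ {δ B} → 0ℚ ℚ.< δ → 0ℚ ℚ.< B → ∃[ η ] (0ℚ ℚ.< η × B ℚ.* η ≡ ½ ℚ.* δ)
scaled {δ} {B} δ>0 B>0 = ½ ℚ.* δ ℚ.* r , η>0 , e
  where
  instance
    B⁺ = ℚ.positive B>0
    B≢0 = ℚ.pos⇒nonZero B
    δ/2⁺ = ℚ.positive (half>0 δ>0)
  r : ℚ
  r = ℚ.1/ B
  η>0 : 0ℚ ℚ.< ½ ℚ.* δ ℚ.* r
  η>0 = ℚ.positive⁻¹ _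
    {{ℚ.pos*pos⇒pos (½ ℚ.* δ) r {{ℚ.1/pos⇒pos B}}}}
  e : B ℚ.* (½ ℚ.* δ ℚ.* r) ≡ ½ ℚ.* δ
  e = trans
    (solve 3 (λ b d r → b :* (d :* r) := d :* (b :* r)) refl B (½ ℚ.* δ) r)
    (trans (cong (½ ℚ.* δ ℚ.*_) (ℚ.*-inverseʳ B)) (ℚ.*-identityʳ _))

*-split : ∀ a b c d →
  a ℚ.* b ≡ c ℚ.* d ℚ.+ (a ℚ.* (b ℚ.- d) ℚ.+ d ℚ.* (a ℚ.- c))
*-split = solve 4
  (λ a b c d → a :* b := c :* d :+ (a :* (b :+ :- d) :+ d :* (a :+ :- c))) refl

*-close : ∀ a b c d {A B η θ} → ℚ.∣ a ∣ ℚ.≤ A → ℚ.∣ d ∣ ℚ.≤ B →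
  ℚ.∣ b ℚ.- d ∣ ℚ.≤ η → ℚ.∣ a ℚ.- c ∣ ℚ.≤ θ →
  a ℚ.* b ℚ.≤ c ℚ.* d ℚ.+ (A ℚ.* η ℚ.+ B ℚ.* θ)
*-close a b c d {A} {B} {η} {θ} ha hd hb hc = begin
  a ℚ.* b
    ≡⟨ *-split a b c d ⟩
  c ℚ.* d ℚ.+ (a ℚ.* (b ℚ.- d) ℚ.+ d ℚ.* (a ℚ.- c))
    ≤⟨ ℚ.+-monoʳ-≤ (c ℚ.* d)
         (ℚ.+-mono-≤ (*-bound a (b ℚ.- d) ha hb) (*-bound d (a ℚ.- c) hd hc)) ⟩
  c ℚ.* d ℚ.+ (A ℚ.* η ℚ.+ B ℚ.* θ) ∎

cauchy-*-at : ∀ x y δ → ((A , _) : Bounded x) → ((B , _) : Bounded y) → ∀ η θ →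
  A ℚ.* η ≡ ½ ℚ.* δ → B ℚ.* θ ≡ ½ ℚ.* δ → CauchyAt y η → CauchyAt x θ →
  CauchyAt (λ n → x n ℚ.* y n) δ
cauchy-*-at x y δ (A , _ , N₁ , hA) (B , _ , N₂ , hB) η θ Aη Bθ (N₃ , hy) (N₄ , hx) =
  (N₁ ℕ.⊔ N₂) ℕ.⊔ (N₃ ℕ.⊔ N₄) , λ m n Nm Nn →
  let m₁₂ = ℕ.m⊔n≤o⇒m≤o (N₁ ℕ.⊔ N₂) (N₃ ℕ.⊔ N₄) Nm
      m₃₄ = ℕ.m⊔n≤o⇒n≤o (N₁ ℕ.⊔ N₂) (N₃ ℕ.⊔ N₄) Nm
      n₁₂ = ℕ.m⊔n≤o⇒m≤o (N₁ ℕ.⊔ N₂) (N₃ ℕ.⊔ N₄) Nn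
      n₃₄ = ℕ.m⊔n≤o⇒n≤o (N₁ ℕ.⊔ N₂) (N₃ ℕ.⊔ N₄) Nn
      m₁ = ℕ.m⊔n≤o⇒m≤o N₁ N₂ m₁₂
      n₂ = ℕ.m⊔n≤o⇒n≤o N₁ N₂ n₁₂
      m₃ = ℕ.m⊔n≤o⇒m≤o N₃ N₄ m₃₄
      m₄ = ℕ.m⊔n≤o⇒n≤o N₃ N₄ m₃₄
      n₃ = ℕ.m⊔n≤o⇒m≤o N₃ N₄ n₃₄
      n₄ = ℕ.m⊔n≤o⇒n≤o N₃ N₄ n₃₄
  in subst (λ t → x m ℚ.* y m ℚ.≤ x n ℚ.* y n ℚ.+ t)
       (trans (cong₂ ℚ._+_ Aη Bθ) (halves δ))
       (*-close (x m) (y m) (x n) (y n) (hA m m₁) (hB n n₂)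
         (∣-∣≤ (hy m n m₃ n₃) (hy n m n₃ m₃))
         (∣-∣≤ (hx m n m₄ n₄) (hx n m n₄ m₄)))

cauchy-* : ∀ {x y} → Cauchy x → Cauchy y → Cauchy (λ n → x n ℚ.* y n)
cauchy-* {x} {y} cx cy δ δ>0 =
  let bx@(_ , A>0 , _) = bounded cx
      by@(_ , B>0 , _) = bounded cy
      η , η>0 , Aη = scaled δ>0 A>0
      θ , θ>0 , Bθ = scaled δ>0 B>0
  in cauchy-*-at x y δ bx by η θ Aη Bθ (cy η η>0) (cx θ θ>0)

infixl 6 _-ᴿ_
_-ᴿ_ : ℝ → ℝ → ℝ
x -ᴿ y = mkℝ (λ n → approx x n ℚ.- approx y n)
             (cauchy-+ (isCauchy x) (cauchy-neg (isCauchy y)))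

infixl 7 _*ᴿ_
_*ᴿ_ : ℝ → ℝ → ℝ
x *ᴿ y = mkℝ (λ n → approx x n ℚ.* approx y n)
             (cauchy-* (isCauchy x) (isCauchy y))

-- 1/(n+1)
recip : ℕ → ℚ
recip n = + 1 / suc n

-- ⌊√q · (m+1)⌋ / (m+1), with √q read as 0 for q < 0; a numerator s with
-- (s/(m+1))² ≤ q satisfies s ≤ s² ≤ q(m+1)² ≤ ∣↥ q∣ (m+1)².
module _ (q : ℚ) (m : ℕ) where
  sqrt-below? : Decidable (λ s → (+ s / suc m) ℚ.* (+ s / suc m) ℚ.≤ q ℚ.⊔ 0ℚ)
  sqrt-below? s = _ ℚ.≤? _

  sqrt-bound : ℕ
  sqrt-bound = ℤ.∣ ℚ.↥ q ∣ ℕ.* (suc m ℕ.* suc m)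

  sqrt-approx : ℚ
  sqrt-approx = + greatest sqrt-below? sqrt-bound / suc m

-- 1/(a+1) + 1/(a+2) + ⋯ + 1/(a+l)
harmonic : ℕ → ℕ → ℚ
harmonic a zero    = 0ℚ
harmonic a (suc l) = harmonic a l ℚ.+ recip (a ℕ.+ l)

frac-≃ : ∀ a b → ℚ.toℚᵘ (+ a / suc b) ℚᵘ.≃ ℚᵘ.mkℚᵘ (+ a) b
frac-≃ a b = ℚ.toℚᵘ-fromℚᵘ (ℚᵘ.mkℚᵘ (+ a) b)

frac-≤ : ∀ a b c d → a ℕ.* suc d ℕ.≤ c ℕ.* suc b → + a / suc b ℚ.≤ + c / suc d
frac-≤ a b c d h = ℚ.toℚᵘ-cancel-≤
  (ℚᵘ.≤-respˡ-≃ (ℚᵘ.≃-sym (frac-≃ a b)) (ℚᵘ.≤-respʳ-≃ (ℚᵘ.≃-sym (frac-≃ c d))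
    (ℚᵘ.*≤* (subst₂ ℤ._≤_ (ℤ.pos-* a (suc d)) (ℤ.pos-* c (suc b)) (ℤ.+≤+ h)))))

frac-≤⁻¹ : ∀ a b c d → + a / suc b ℚ.≤ + c / suc d → a ℕ.* suc d ℕ.≤ c ℕ.* suc b
frac-≤⁻¹ a b c d h = ℤ.drop‿+≤+
  (subst₂ ℤ._≤_ (sym (ℤ.pos-* a (suc d))) (sym (ℤ.pos-* c (suc b)))
    (ℚᵘ.drop-*≤* (ℚᵘ.≤-respˡ-≃ (frac-≃ a b) (ℚᵘ.≤-respʳ-≃ (frac-≃ c d)
      (ℚ.toℚᵘ-mono-≤ h)))))

frac-* : ∀ a b c d →
  (+ a / suc b) ℚ.* (+ c / suc d) ≡ + (a ℕ.* c) / (suc b ℕ.* suc d)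
frac-* a b c d = ℚ.toℚᵘ-injective (ℚᵘ.≃-trans (ℚ.toℚᵘ-homo-* (+ a / suc b) (+ c / suc d))
  (ℚᵘ.≃-trans (ℚᵘ.*-cong (frac-≃ a b) (frac-≃ c d))
    (ℚᵘ.≃-trans
      (ℚᵘ.*≡* (cong (ℤ._* + (suc b ℕ.* suc d)) (sym (ℤ.pos-* a c))))
      (ℚᵘ.≃-sym (frac-≃ (a ℕ.* c) (d ℕ.+ b ℕ.* suc d))))))

frac-+ : ∀ a b c → (+ a / suc c) ℚ.+ (+ b / suc c) ≡ + (a ℕ.+ b) / suc c
frac-+ a b c = ℚ.toℚᵘ-injective (ℚᵘ.≃-trans (ℚ.toℚᵘ-homo-+ (+ a / suc c) (+ b / suc c))
  (ℚᵘ.≃-trans (ℚᵘ.+-cong (frac-≃ a c) (frac-≃ b c))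
    (ℚᵘ.≃-trans (ℚᵘ.*≡* e) (ℚᵘ.≃-sym (frac-≃ (a ℕ.+ b) c)))))
  where
  C = + suc c
  e : (+ a ℤ.* C ℤ.+ + b ℤ.* C) ℤ.* C ≡ + (a ℕ.+ b) ℤ.* (C ℤ.* C)
  e = trans (cong (ℤ._* C) (trans (sym (ℤ.*-distribʳ-+ C (+ a) (+ b)))
                                  (cong (ℤ._* C) (sym (ℤ.pos-+ a b)))))
            (ℤ.*-assoc (+ (a ℕ.+ b)) C C)

recip-small : ∀ δ → 0ℚ ℚ.< δ → ∃[ N ] (∀ n → N ℕ.≤ n → recip n ℚ.≤ δ)
recip-small δ@(ℚ.mkℚ (ℤ.+[1+ k ]) d _) _ = d , λ n d≤n →
  subst (recip n ℚ.≤_) (ℚ.↥p/↧p≡p δ)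
    (frac-≤ 1 n (suc k) d
      (ℕ.≤-trans (ℕ.≤-reflexive (ℕ.*-identityˡ (suc d)))
        (ℕ.≤-trans (ℕ.s≤s d≤n) (ℕ.m≤n*m (suc n) (suc k)))))
recip-small (ℚ.mkℚ (+ zero) d _) 0<δ =
  contradiction (ℚ.drop-*<* 0<δ) (ℤ.<-irrefl refl)
recip-small (ℚ.mkℚ ℤ.-[1+ k ] d _) 0<δ = case ℚ.drop-*<* 0<δ of λ ()

frac≥0 : ∀ a b → 0ℚ ℚ.≤ + a / suc b
frac≥0 a b = frac-≤ 0 0 a b ℕ.z≤n

sq≥ : ∀ {a b} → 0ℚ ℚ.≤ a → a ℚ.≤ b → a ℚ.* a ℚ.≤ b ℚ.* b
sq≥ {a} {b} 0≤a a≤b = begin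
  a ℚ.* a  ≤⟨ ℚ.*-monoʳ-≤-nonNeg a {{ℚ.nonNegative 0≤a}} a≤b ⟩
  b ℚ.* a  ≤⟨ ℚ.*-monoˡ-≤-nonNeg b
                {{ℚ.nonNegative (ℚ.≤-trans 0≤a a≤b)}} a≤b ⟩
  b ℚ.* b  ∎

sq-cancel : ∀ {a b} → 0ℚ ℚ.≤ b → a ℚ.* a ℚ.≤ b ℚ.* b → a ℚ.≤ b
sq-cancel {a} {b} 0≤b h = ℚ.≮⇒≥ λ b<a → ℚ.<-irrefl refl (begin-strict
  b ℚ.* b  ≤⟨ ℚ.*-monoˡ-≤-nonNeg b {{ℚ.nonNegative 0≤b}} (ℚ.<⇒≤ b<a) ⟩
  b ℚ.* a  <⟨ ℚ.*-monoˡ-<-pos a {{ℚ.positive (ℚ.≤-<-trans 0≤b b<a)}} b<a ⟩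
  a ℚ.* a  ≤⟨ h ⟩
  b ℚ.* b  ∎)

q⊔0≤∣↥q∣ : ∀ q → q ℚ.⊔ 0ℚ ℚ.≤ + ℤ.∣ ℚ.↥ q ∣ / 1
q⊔0≤∣↥q∣ q@record{} = ℚ.⊔-lub
  (ℚ.≤-trans (p≤∣p∣ q)
    (subst (ℚ._≤ + ℤ.∣ ℚ.↥ q ∣ / 1) (ℚ.↥p/↧p≡p ℚ.∣ q ∣)
      (frac-≤ ℤ.∣ ℚ.↥ q ∣ _ ℤ.∣ ℚ.↥ q ∣ 0
        (ℕ.*-monoʳ-≤ ℤ.∣ ℚ.↥ q ∣ (ℕ.s≤s ℕ.z≤n)))))
  (frac≥0 ℤ.∣ ℚ.↥ q ∣ 0)

module _ (q : ℚ) (m : ℕ) where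
  private r = sqrt-approx q m

  sqrt-lower : r ℚ.* r ℚ.≤ q ℚ.⊔ 0ℚ
  sqrt-lower = greatest-satisfies (sqrt-below? q m) (sqrt-bound q m)
    (ℚ.≤-trans (ℚ.≤-reflexive (trans (cong (ℚ._* (+ 0 / suc m)) (ℚ.0/n≡0 (suc m)))
                                     (ℚ.*-zeroˡ (+ 0 / suc m))))
               (ℚ.p≤q⊔p q 0ℚ))

  sqrt-upper : q ℚ.⊔ 0ℚ ℚ.≤ (r ℚ.+ recip m) ℚ.* (r ℚ.+ recip m)
  sqrt-upper = subst (λ t → q ℚ.⊔ 0ℚ ℚ.≤ t ℚ.* t)
    (trans (cong (λ t → + t / suc m) (ℕ.+-comm 1 g)) (sym (frac-+ g 1 m)))
    (ℚ.≮⇒≥ λ lt → ℕ.<-irrefl refl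
      (greatest-upper (sqrt-below? q m) (bound (ℚ.<⇒≤ lt)) (ℚ.<⇒≤ lt)))
    where
    g = greatest (sqrt-below? q m) (sqrt-bound q m)
    bound : ∀ {s} → (+ suc s / suc m) ℚ.* (+ suc s / suc m) ℚ.≤ q ℚ.⊔ 0ℚ →
            suc s ℕ.≤ sqrt-bound q m
    bound {s} h = ℕ.≤-trans (ℕ.m≤m*n (suc s) (suc s))
      (ℕ.≤-trans (ℕ.≤-reflexive (sym (ℕ.*-identityʳ _)))
        (frac-≤⁻¹ (suc s ℕ.* suc s) _ ℤ.∣ ℚ.↥ q ∣ 0
          (ℚ.≤-trans (ℚ.≤-reflexive (sym (frac-* (suc s) m (suc s) m)))
            (ℚ.≤-trans h (q⊔0≤∣↥q∣ q)))))

prod≥0 : ∀ {a b} → 0ℚ ℚ.≤ a → 0ℚ ℚ.≤ b → 0ℚ ℚ.≤ a ℚ.* b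
prod≥0 {a} {b} a≥0 b≥0 = subst (ℚ._≤ a ℚ.* b) (ℚ.*-zeroʳ a)
  (ℚ.*-monoˡ-≤-nonNeg a {{ℚ.nonNegative a≥0}} b≥0)

square-sum : ∀ {s h} → 0ℚ ℚ.≤ s → 0ℚ ℚ.≤ h →
  s ℚ.* s ℚ.+ h ℚ.* h ℚ.≤ (s ℚ.+ h) ℚ.* (s ℚ.+ h)
square-sum {s} {h} s≥0 h≥0 = begin
  s ℚ.* s ℚ.+ h ℚ.* h
    ≡⟨ ℚ.+-identityʳ _ ⟨
  s ℚ.* s ℚ.+ h ℚ.* h ℚ.+ 0ℚ
    ≤⟨ ℚ.+-monoʳ-≤ (s ℚ.* s ℚ.+ h ℚ.* h)
         (ℚ.+-mono-≤ (prod≥0 s≥0 h≥0) (prod≥0 s≥0 h≥0)) ⟩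
  s ℚ.* s ℚ.+ h ℚ.* h ℚ.+ (s ℚ.* h ℚ.+ s ℚ.* h)
    ≡⟨ solve 2 (λ s h → s :* s :+ h :* h :+ (s :* h :+ s :* h)
                      := (s :+ h) :* (s :+ h)) refl s h ⟩
  (s ℚ.+ h) ℚ.* (s ℚ.+ h) ∎

-- p and r approximate √a and √b.
sqrt-close : ∀ {a b p r e η} → 0ℚ ℚ.≤ r → 0ℚ ℚ.≤ e → e ℚ.≤ η →
  p ℚ.* p ℚ.≤ a ℚ.⊔ 0ℚ → b ℚ.⊔ 0ℚ ℚ.≤ (r ℚ.+ e) ℚ.* (r ℚ.+ e) →
  a ℚ.≤ b ℚ.+ η ℚ.* η → p ℚ.≤ r ℚ.+ η ℚ.+ η
sqrt-close {a} {b} {p} {r} {e} {η} r≥0 e≥0 e≤η lo up a≤b = sq-cancel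
  (ℚ.+-mono-≤ t≥0 η≥0)
  (ℚ.≤-trans lo (ℚ.≤-trans
    (ℚ.⊔-lub (ℚ.≤-trans a≤b (ℚ.+-monoˡ-≤ (η ℚ.* η) b≤))
             (ℚ.+-mono-≤ (prod≥0 t≥0 t≥0) (prod≥0 η≥0 η≥0)))
    (square-sum t≥0 η≥0)))
  where
  η≥0 : 0ℚ ℚ.≤ η
  η≥0 = ℚ.≤-trans e≥0 e≤η
  t≥0 : 0ℚ ℚ.≤ r ℚ.+ η
  t≥0 = ℚ.+-mono-≤ r≥0 η≥0
  b≤ : b ℚ.≤ (r ℚ.+ η) ℚ.* (r ℚ.+ η)
  b≤ = ℚ.≤-trans (ℚ.p≤p⊔q b 0ℚ) (ℚ.≤-trans up
    (sq≥ (ℚ.+-mono-≤ r≥0 e≥0) (ℚ.+-monoʳ-≤ r e≤η)))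

cauchy-√-at : ∀ x η → CauchyAt x (η ℚ.* η) →
  ∃[ M ] (∀ n → M ℕ.≤ n → recip n ℚ.≤ η) →
  CauchyAt (λ n → sqrt-approx (x n) n) (η ℚ.+ η)
cauchy-√-at x η (N , hx) (M , hr) = N ℕ.⊔ M , λ m n Nm Nn →
  subst (sqrt-approx (x m) m ℚ.≤_) (ℚ.+-assoc (sqrt-approx (x n) n) η η)
    (sqrt-close {a = x m} {b = x n}
      (frac≥0 (greatest (sqrt-below? (x n) n) (sqrt-bound (x n) n)) n)
      (frac≥0 1 n)
      (hr n (ℕ.m⊔n≤o⇒n≤o N M Nn))
      (sqrt-lower (x m) m) (sqrt-upper (x n) n)
      (hx m n (ℕ.m⊔n≤o⇒m≤o N M Nm) (ℕ.m⊔n≤o⇒m≤o N M Nn)))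

cauchy-√ : ∀ {x} → Cauchy x → Cauchy (λ n → sqrt-approx (x n) n)
cauchy-√ {x} cx δ δ>0 =
  subst (CauchyAt (λ n → sqrt-approx (x n) n)) (halves δ)
    (cauchy-√-at x η (cx (η ℚ.* η) η²>0) (recip-small η η>0))
  where
  η = ½ ℚ.* δ
  η>0 : 0ℚ ℚ.< η
  η>0 = half>0 δ>0
  η²>0 : 0ℚ ℚ.< η ℚ.* η
  η²>0 = ℚ.positive⁻¹ (η ℚ.* η)
    {{ℚ.pos*pos⇒pos η {{ℚ.positive η>0}} η {{ℚ.positive η>0}}}}

frac-equal : ∀ a b c d → a ℕ.* suc d ≡ c ℕ.* suc b → + a / suc b ≡ + c / suc d
frac-equal a b c d e = ℚ.≤-antisym
  (frac-≤ a b c d (ℕ.≤-reflexive e)) (frac-≤ c d a b (ℕ.≤-reflexive (sym e)))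

suc-* : ∀ k q → (+ suc k / 1) ℚ.* q ≡ (+ k / 1) ℚ.* q ℚ.+ q
suc-* k q = trans
  (cong (ℚ._* q) (sym (trans (frac-+ k 1 0) (cong (λ t → + t / 1) (ℕ.+-comm k 1)))))
  (solve 2 (λ a q → (a :+ con 1ℚ) :* q := a :* q :+ q) refl (+ k / 1) q)

recip-anti : ∀ {a b} → a ℕ.≤ b → recip b ℚ.≤ recip a
recip-anti {a} {b} a≤b = frac-≤ 1 b 1 a
  (ℕ.*-monoʳ-≤ 1 (ℕ.s≤s a≤b))

harmonic-≤ : ∀ a l → harmonic a l ℚ.≤ (+ l / 1) ℚ.* recip a
harmonic-≤ a zero = ℚ.≤-reflexive (sym (ℚ.*-zeroˡ (recip a)))
harmonic-≤ a (suc l) = subst (harmonic a (suc l) ℚ.≤_) (sym (suc-* l (recip a)))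
  (ℚ.+-mono-≤ (harmonic-≤ a l) (recip-anti (ℕ.m≤m+n a l)))

harmonic-≥ : ∀ a l b → (∀ i → i ℕ.< l → a ℕ.+ i ℕ.≤ b) →
             (+ l / 1) ℚ.* recip b ℚ.≤ harmonic a l
harmonic-≥ a zero b _ = ℚ.≤-reflexive (ℚ.*-zeroˡ (recip b))
harmonic-≥ a (suc l) b h = subst (ℚ._≤ harmonic a (suc l)) (sym (suc-* l (recip b)))
  (ℚ.+-mono-≤ (harmonic-≥ a l b (λ i i<l → h i (ℕ.m<n⇒m<1+n i<l)))
              (recip-anti (h l ℕ.≤-refl)))

harmonic-++ : ∀ a l k → harmonic a (l ℕ.+ k) ≡ harmonic a l ℚ.+ harmonic (a ℕ.+ l) k
harmonic-++ a l zero = trans (cong (harmonic a) (ℕ.+-identityʳ l))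
                             (sym (ℚ.+-identityʳ _))
harmonic-++ a l (suc k) = trans (cong (harmonic a) (ℕ.+-suc l k))
  (trans (cong₂ ℚ._+_ (harmonic-++ a l k) (cong recip (sym (ℕ.+-assoc a l k))))
         (ℚ.+-assoc (harmonic a l) (harmonic (a ℕ.+ l) k) _))

module _ (k : ℕ) where
  private K = suc k

  block-upper : ∀ c → harmonic (suc c ℕ.* K) K ℚ.≤ recip c
  block-upper c = begin
    harmonic (suc c ℕ.* K) K                   ≤⟨ harmonic-≤ (suc c ℕ.* K) K ⟩
    (+ K / 1) ℚ.* recip (suc c ℕ.* K)          ≡⟨ frac-* K 0 1 (suc c ℕ.* K) ⟩
    + (K ℕ.* 1) / (1 ℕ.* suc (suc c ℕ.* K))    ≤⟨ frac-≤ (K ℕ.* 1) _ 1 c (cross) ⟩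
    recip c                                    ∎
    where
    cross : K ℕ.* 1 ℕ.* suc c ℕ.≤ 1 ℕ.* (1 ℕ.* suc (suc c ℕ.* K))
    cross = subst₂ ℕ._≤_
      (trans (ℕ.*-comm (suc c) K) (cong (ℕ._* suc c) (sym (ℕ.*-identityʳ K))))
      (sym (trans (ℕ.*-identityˡ _) (ℕ.*-identityˡ _)))
      (ℕ.n≤1+n (suc c ℕ.* K))

  block-lower : ∀ c → recip c ℚ.≤ harmonic (c ℕ.* K) K
  block-lower c = begin
    recip c
      ≡⟨ frac-equal 1 c (K ℕ.* 1) _ e ⟩
    + (K ℕ.* 1) / (1 ℕ.* suc (k ℕ.+ c ℕ.* K))
      ≡⟨ frac-* K 0 1 (k ℕ.+ c ℕ.* K) ⟨
    (+ K / 1) ℚ.* recip (k ℕ.+ c ℕ.* K)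
      ≤⟨ harmonic-≥ (c ℕ.* K) K _ (λ i i<K →
           ℕ.≤-trans (ℕ.≤-reflexive (ℕ.+-comm (c ℕ.* K) i))
                     (ℕ.+-monoˡ-≤ (c ℕ.* K) (ℕ.s≤s⁻¹ i<K))) ⟩
    harmonic (c ℕ.* K) K ∎
    where
    e : 1 ℕ.* (1 ℕ.* (suc c ℕ.* K)) ≡ K ℕ.* 1 ℕ.* suc c
    e = trans (trans (ℕ.*-identityˡ _) (ℕ.*-identityˡ _))
          (trans (ℕ.*-comm (suc c) K) (cong (ℕ._* suc c) (sym (ℕ.*-identityʳ K))))

  split : ∀ M l → harmonic (M ℕ.* K) (suc l ℕ.* K)
                ≡ harmonic (M ℕ.* K) (l ℕ.* K) ℚ.+ harmonic ((M ℕ.+ l) ℕ.* K) K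
  split M l = trans (cong (harmonic (M ℕ.* K)) (ℕ.+-comm K (l ℕ.* K)))
    (trans (harmonic-++ (M ℕ.* K) (l ℕ.* K) K)
      (cong (λ t → harmonic (M ℕ.* K) (l ℕ.* K) ℚ.+ harmonic t K)
            (sym (ℕ.*-distribʳ-+ K M l))))

  refine-lower : ∀ M l → harmonic M l ℚ.≤ harmonic (M ℕ.* K) (l ℕ.* K)
  refine-lower M zero = ℚ.≤-refl
  refine-lower M (suc l) = subst (harmonic M (suc l) ℚ.≤_) (sym (split M l))
    (ℚ.+-mono-≤ (refine-lower M l) (block-lower (M ℕ.+ l)))

  refine-upper′ : ∀ m l →
    harmonic (suc m ℕ.* K) (l ℕ.* K) ℚ.+ recip (m ℕ.+ l) ℚ.≤
    harmonic (suc m) l ℚ.+ recip m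
  refine-upper′ m zero = ℚ.≤-reflexive (cong (λ t → 0ℚ ℚ.+ recip t) (ℕ.+-identityʳ m))
  refine-upper′ m (suc l) = begin
    harmonic (suc m ℕ.* K) (suc l ℕ.* K) ℚ.+ recip (m ℕ.+ suc l)
      ≡⟨ cong₂ ℚ._+_ (split (suc m) l) (cong recip (ℕ.+-suc m l)) ⟩
    (U ℚ.+ B) ℚ.+ T
      ≤⟨ ℚ.+-monoˡ-≤ T (ℚ.+-monoʳ-≤ U (block-upper (m ℕ.+ l))) ⟩
    (U ℚ.+ recip (m ℕ.+ l)) ℚ.+ T
      ≤⟨ ℚ.+-monoˡ-≤ T (refine-upper′ m l) ⟩
    (harmonic (suc m) l ℚ.+ recip m) ℚ.+ T
      ≡⟨ solve 3 (λ a b c → (a :+ b) :+ c := (a :+ c) :+ b)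
           refl (harmonic (suc m) l) (recip m) T ⟩
    harmonic (suc m) (suc l) ℚ.+ recip m ∎
    where
    U = harmonic (suc m ℕ.* K) (l ℕ.* K)
    B = harmonic ((suc m ℕ.+ l) ℕ.* K) K
    T = recip (suc (m ℕ.+ l))

  refine-upper : ∀ m l →
    harmonic (suc m ℕ.* K) (l ℕ.* K) ℚ.≤ harmonic (suc m) l ℚ.+ recip m
  refine-upper m l = begin
    H                          ≡⟨ ℚ.+-identityʳ H ⟨
    H ℚ.+ 0ℚ                   ≤⟨ ℚ.+-monoʳ-≤ H (frac≥0 1 (m ℕ.+ l)) ⟩
    H ℚ.+ recip (m ℕ.+ l)      ≤⟨ refine-upper′ m l ⟩
    harmonic (suc m) l ℚ.+ recip m ∎
    where H = harmonic (suc m ℕ.* K) (l ℕ.* K)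

cauchy-log : ∀ l → Cauchy (λ m → harmonic (suc m) (l ℕ.* suc m))
cauchy-log l δ δ>0 with recip-small δ δ>0
... | N , h = N , λ m n _ Nn → begin
  harmonic (suc m) (l ℕ.* suc m)
    ≤⟨ refine-lower n (suc m) (l ℕ.* suc m) ⟩
  harmonic (suc m ℕ.* suc n) (l ℕ.* suc m ℕ.* suc n)
    ≡⟨ cong₂ harmonic (ℕ.*-comm (suc m) (suc n)) (trans (ℕ.*-assoc l (suc m) (suc n))
         (trans (cong (l ℕ.*_) (ℕ.*-comm (suc m) (suc n)))
                (sym (ℕ.*-assoc l (suc n) (suc m))))) ⟩
  harmonic (suc n ℕ.* suc m) (l ℕ.* suc n ℕ.* suc m)
    ≤⟨ refine-upper m n (l ℕ.* suc n) ⟩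
  harmonic (suc n) (l ℕ.* suc n) ℚ.+ recip n
    ≤⟨ ℚ.+-monoʳ-≤ (harmonic (suc n) (l ℕ.* suc n)) (h n Nn) ⟩
  harmonic (suc n) (l ℕ.* suc n) ℚ.+ δ ∎

-- √(max(x,0))
infix 8 √_
√_ : ℝ → ℝ
√ x = mkℝ (λ m → sqrt-approx (approx x m) m) (cauchy-√ (isCauchy x))

-- log n = ∫₁ⁿ dt/t for n ≥ 1, as the limit over M = m+1 of the Riemann sums
-- with mesh 1/M and right endpoints 1 + j/M, 1 ≤ j ≤ (n-1)M:
-- Σⱼ (1/M) · 1/(1 + j/M) = Σⱼ 1/(M+j).  (log 0 is the junk value 0.)
log : ℕ → ℝ
log n = mkℝ (λ m → harmonic (suc m) ((n ℕ.∸ 1) ℕ.* suc m)) (cauchy-log (n ℕ.∸ 1))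

------------------------------------------------------------------------
-- Hypergraphs

-- The edges are the sets  edge j; injectivity excludes repeated edges, so a
-- set of edges is a  Subset size.
record Hypergraph (n : ℕ) : Set where
  field
    size     : ℕ
    edge     : Fin size → Subset n
    distinct : ∀ {i j} → edge i ≡ edge j → i ≡ j

module _ {n : ℕ} (H : Hypergraph n) where
  open Hypergraph H

  record Subhypergraph : Set where
    constructor mkSub
    field
      vertices : Subset n
      edges    : Subset size
      .closed  : ∀ j → j ∈ edges → edge j ⊆ vertices

open Subhypergraph public using (vertices; edges)

module _ {n : ℕ} {H : Hypergraph n} where
  open Hypergraph H

  infix 4 _⊑_
  _⊑_ : Subhypergraph H → Subhypergraph H → Set
  K ⊑ L = vertices K ⊆ vertices L × edges K ⊆ edges L

  ShadowEdge : Subhypergraph H → Fin n → Fin n → Set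
  ShadowEdge K x y = x ≢ y × ∃[ j ] (j ∈ edges K × x ∈ edge j × y ∈ edge j)

  -- The graph with no vertices is not counted as connected.
  Connected : Subhypergraph H → Set
  Connected K = Nonempty (vertices K) ×
    (∀ x → x ∈ vertices K → ∀ y → y ∈ vertices K → Star (ShadowEdge K) x y)

  IsComponent : Subhypergraph H → Subhypergraph H → Set
  IsComponent L K = K ⊑ L × Connected K ×
    (∀ K′ → K′ ⊑ L → Connected K′ → K ⊑ K′ → K′ ⊑ K)

-- The color classes  {j ∣ lookup c j ≡ i}  may be empty.
Coloring : {n : ℕ} → ℕ → Hypergraph n → Set
Coloring r H = Vec (Fin r) (Hypergraph.size H)

module _ {n r : ℕ} (H : Hypergraph n) where
  open Hypergraph H

  colorClass : Coloring r H → Fin r → Subhypergraph H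
  colorClass c i =
    mkSub ⊤ (tabulate λ j → does (lookup c j Fin.≟ i)) λ _ _ _ → ∈⊤

  MonochromaticComponent : Coloring r H → Subhypergraph H → Set
  MonochromaticComponent c K = ∃[ i ] IsComponent (colorClass c i) K

module _ {n : ℕ} (H : Hypergraph n) where
  open Hypergraph H

  ForcesComponent : ℕ → ℕ → Set
  ForcesComponent r m = ∀ (c : Coloring r H) →
    ∃[ K ] (MonochromaticComponent H c K × m ℕ.≤ card (vertices K))

  TripleOfSize : ℕ → Set
  TripleOfSize a = ∃[ X₁ ] ∃[ X₂ ] ∃[ X₃ ]
    ( (card X₁ ≡ a × card X₂ ≡ a × card X₃ ≡ a)
    × (Empty (X₁ ∩ X₂) × Empty (X₁ ∩ X₃) × Empty (X₂ ∩ X₃))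
    × (∀ j → Empty (edge j ∩ X₁) ⊎ Empty (edge j ∩ X₂) ⊎ Empty (edge j ∩ X₃)))

all-Vec? : ∀ {r} k {P : Vec (Fin r) k → Set} → Decidable P → Dec (∀ v → P v)
all-Vec? zero    P? = map′ (λ { p [] → p }) (λ f → f []) (P? [])
all-Vec? (suc k) P? = map′ (λ { f (i ∷ v) → f i v }) (λ f i v → f (i ∷ v))
  (Fin.all? λ i → all-Vec? k (λ v → P? (i ∷ v)))

-- Floyd–Warshall: Via k x y says that y is reachable from x through
-- intermediate vertices among the first k entries of  vs.
module Reachability {n : ℕ} {R : Fin n → Fin n → Set}
                    (R? : ∀ x y → Dec (R x y)) where

  Via : ∀ k → (Fin k → Fin n) → Fin n → Fin n → Set
  Via zero    vs x y = x ≡ y ⊎ R x y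
  Via (suc k) vs x y = Via k (vs ∘ suc) x y ⊎
    (Via k (vs ∘ suc) x (vs zero) × Via k (vs ∘ suc) (vs zero) y)

  via? : ∀ k vs x y → Dec (Via k vs x y)
  via? zero    vs x y = (x Fin.≟ y) ⊎-dec R? x y
  via? (suc k) vs x y = via? k _ x y ⊎-dec (via? k _ x _ ×-dec via? k _ _ y)

  via⇒star : ∀ k vs {x y} → Via k vs x y → Star R x y
  via⇒star zero    vs (inj₁ refl) = ε
  via⇒star zero    vs (inj₂ r)    = r ◅ ε
  via⇒star (suc k) vs (inj₁ p)       = via⇒star k _ p
  via⇒star (suc k) vs (inj₂ (p , q)) = via⇒star k _ p ◅◅ via⇒star k _ q

  step : ∀ k vs {x y} → x ≡ y ⊎ R x y → Via k vs x y
  step zero    vs s = s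
  step (suc k) vs s = inj₁ (step k _ s)

  to : ∀ k vs {x} → Via (suc k) vs x (vs zero) → Via k (vs ∘ suc) x (vs zero)
  to k vs (inj₁ p)       = p
  to k vs (inj₂ (p , _)) = p

  from : ∀ k vs {y} → Via (suc k) vs (vs zero) y → Via k (vs ∘ suc) (vs zero) y
  from k vs (inj₁ p)       = p
  from k vs (inj₂ (_ , q)) = q

  join : ∀ k vs i {x y} → Via k vs x (vs i) → Via k vs (vs i) y → Via k vs x y
  join (suc k) vs zero    p q = inj₂ (to k vs p , from k vs q)
  join (suc k) vs (suc i) (inj₁ p) (inj₁ q) = inj₁ (join k _ i p q)
  join (suc k) vs (suc i) (inj₁ p) (inj₂ (q , q′)) = inj₂ (join k _ i p q , q′)
  join (suc k) vs (suc i) (inj₂ (p , p′)) (inj₁ q) = inj₂ (p , join k _ i p′ q)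
  join (suc k) vs (suc i) (inj₂ (p , _)) (inj₂ (_ , q)) = inj₂ (p , q)

  star⇒via : ∀ {x y} → Star R x y → Via n (λ i → i) x y
  star⇒via ε = step n _ (inj₁ refl)
  star⇒via (_◅_ {j = z} r s) = join n (λ i → i) z (step n _ (inj₂ r)) (star⇒via s)

  star? : ∀ x y → Dec (Star R x y)
  star? x y = map′ (via⇒star n _) star⇒via (via? n _ x y)

module _ {n : ℕ} {H : Hypergraph n} where
  open Hypergraph H

  closed? : (V : Subset n) (E : Subset size) → Dec (∀ j → j ∈ E → edge j ⊆ V)
  closed? V E = Fin.all? λ j → (j ∈? E) →-dec (edge j ⊆? V)

  any-Sub? : {P : Subhypergraph H → Set} → Decidable P → Dec (∃ P)
  any-Sub? {P} P? = map′
    (λ { (V , E , cl , p) → mkSub V E cl , p })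
    (λ { (mkSub V E cl , p) → V , E , recompute (closed? V E) cl , p })
    (anySubset? λ V → anySubset? λ E → at? V E)
    where
    at? : ∀ V E → Dec (Σ (∀ j → j ∈ E → edge j ⊆ V) λ cl → P (mkSub V E cl))
    at? V E with closed? V E
    ... | no ¬c = no (¬c ∘ proj₁)
    ... | yes c = map′ (c ,_) proj₂ (P? (mkSub V E c))

  all-Sub? : {P : Subhypergraph H → Set} → Decidable P → Dec (∀ K → P K)
  all-Sub? P? = map′
    (λ none K → decidable-stable (P? K) (λ ¬p → none (K , ¬p)))
    (λ all (K , ¬p) → ¬p (all K))
    (¬? (any-Sub? (¬? ∘ P?)))

  _⊑?_ : (K L : Subhypergraph H) → Dec (K ⊑ L)
  K ⊑? L = (vertices K ⊆? vertices L) ×-dec (edges K ⊆? edges L)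

  shadowEdge? : ∀ (K : Subhypergraph H) x y → Dec (ShadowEdge K x y)
  shadowEdge? K x y = ¬? (x Fin.≟ y) ×-dec
    Fin.any? λ j → (j ∈? edges K) ×-dec (x ∈? edge j) ×-dec (y ∈? edge j)

  connected? : (K : Subhypergraph H) → Dec (Connected K)
  connected? K = nonempty? (vertices K) ×-dec
    Fin.all? λ x → (x ∈? vertices K) →-dec
    Fin.all? λ y → (y ∈? vertices K) →-dec
    Reachability.star? (shadowEdge? K) x y

  isComponent? : (L K : Subhypergraph H) → Dec (IsComponent L K)
  isComponent? L K = (K ⊑? L) ×-dec connected? K ×-dec
    all-Sub? λ K′ → (K′ ⊑? L) →-dec connected? K′ →-dec (K ⊑? K′) →-dec (K′ ⊑? K)

empty? : ∀ {n} (X : Subset n) → Dec (Empty X)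
empty? X = ¬? (nonempty? X)

module _ {n : ℕ} (H : Hypergraph n) where
  open Hypergraph H

  forcesComponent? : ∀ r → Decidable (ForcesComponent H r)
  forcesComponent? r m = all-Vec? size λ c → any-Sub? λ K →
    Fin.any? (λ i → isComponent? (colorClass H c i) K) ×-dec (m ℕ.≤? card (vertices K))

  tripleOfSize? : Decidable (TripleOfSize H)
  tripleOfSize? a = anySubset? λ X₁ → anySubset? λ X₂ → anySubset? λ X₃ →
    ((card X₁ ℕ.≟ a) ×-dec (card X₂ ℕ.≟ a) ×-dec (card X₃ ℕ.≟ a)) ×-dec
    (empty? (X₁ ∩ X₂) ×-dec empty? (X₁ ∩ X₃) ×-dec empty? (X₂ ∩ X₃)) ×-dec
    Fin.all? λ j → empty? (edge j ∩ X₁) ⊎-dec empty? (edge j ∩ X₂)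
                   ⊎-dec empty? (edge j ∩ X₃)

-- A set of vertices has at most n elements, so searching up to n finds the
-- maximum. The default value 0 of  greatest  is never used when r ≥ 1, n ≥ 1.
mc : {n : ℕ} → ℕ → Hypergraph n → ℕ
mc {n} r H = greatest (forcesComponent? H r) n

α₃* : {n : ℕ} → Hypergraph n → ℕ
α₃* {n} H = greatest (tripleOfSize? H) n

SteinerTripleSystem : {n : ℕ} → Hypergraph n → Set
SteinerTripleSystem H =
  (∀ j → card (edge j) ≡ 3) ×
  (∀ x y → x ≢ y → ∃! _≡_ λ j → x ∈ edge j × y ∈ edge j)
  where open Hypergraph H

{-# OPTIONS --safe #-}

module Submission where

-- Color each edge by some i such that it misses X_i: a component of color i that
-- meets X_i is a single vertex, so every monochromatic component has at most n - |X_i| vertices.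
--
-- For the lower bound on α₃*, fix X₁ of size a and choose the vertices of X₂ one at a time from a
-- pool, keeping the set A of vertices not yet on an edge meeting both X₁ and X₂. Every z ∈ A is on
-- at most a edges through X₁, so by averaging some vertex of a pool of size D costs A only a
-- fraction a/D of its elements; hence D/(2a) choices at most halve A. With a ≈ √(n log₂ n / 32)
-- this leaves |A| ≥ a after a choices, and X₃ can be taken in A. When n ≤ 4096 any X₁ and X₂ of
-- size a with a² + 3a ≤ n leave enough vertices.
open import Defs
open import Data.Bool using (true; false)
open import Data.Fin using (Fin; zero; suc)
import Data.Fin.Properties as Fin
open import Data.Fin.Subset as Subset using (Subset; inside; outside; _∩_; Empty)
  renaming (∣_∣ to card)
import Data.Fin.Subset.Properties as Subset
open import Data.Integer using (+_)
open import Data.List using (List; []; _∷_; _++_; length; map; filter; take; drop; allFin)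
import Data.List.Properties as List
open import Data.List.Membership.Propositional using (_∈_; _∉_)
open import Data.List.Membership.DecPropositional using () renaming (_∈?_ to member?)
open import Data.List.Membership.Propositional.Properties
  using (∈-∃++; ∈-++⁺ˡ; ∈-++⁺ʳ; ∈-++⁻; ∈-filter⁻)
open import Data.List.Relation.Binary.Permutation.Propositional
  using (_↭_; ↭-refl; ↭-sym; ↭-trans; ↭-reflexive; ↭⇒↭ₛ)
open import Data.List.Relation.Binary.Permutation.Propositional.Properties
  using (↭-length; ++⁺ˡ; ∈-resp-↭; filter-↭) renaming (shift to ↭-shift)
import Data.List.Relation.Binary.Permutation.Setoid.Properties as ↭ₛ
open import Data.List.Relation.Binary.Subset.Propositional using (_⊆_)
open import Data.List.Relation.Unary.All as All using (All; []; _∷_)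
import Data.List.Relation.Unary.All.Properties as All
open import Data.List.Relation.Unary.AllPairs using ([]; _∷_)
open import Data.List.Relation.Unary.Any as Any using (Any; here; there; any?)
open import Data.List.Relation.Unary.Unique.Propositional using (Unique)
import Data.List.Relation.Unary.Unique.Propositional.Properties as Unique
open import Data.Nat using (ℕ; zero; suc; _+_; _*_; _∸_; _^_; _≤_; _<_; _>_; _≤?_; z≤n; s≤s;
  >-nonZero⁻¹)
open import Data.Nat.ListAction using (sum)
open import Data.Nat.Properties
open import Data.Nat.Solver using () renaming (module +-*-Solver to ℕ-Solver)
open import Data.Product using (_×_; _,_; proj₁; proj₂; ∃-syntax)
open import Data.Rational as ℚ using (ℚ; 0ℚ; 1ℚ; _/_; _÷_)
import Data.Rational.Properties as ℚ
open import Data.Rational.Solver using () renaming (module +-*-Solver to ℚ-Solver)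
open import Data.Sum using (_⊎_; inj₁; inj₂)
open import Data.Vec as Vec using ([]; _∷_)
import Data.Vec.Properties as Vec
open import Function using (_∘_; id)
open import Level using (0ℓ)
open import Relation.Binary.Construct.Closure.ReflexiveTransitive using (ε; _◅_)
open import Relation.Binary.PropositionalEquality
open import Relation.Nullary using (¬_; Dec; yes; no; does; contradiction)
open import Relation.Nullary.Decidable using (¬?; dec-true; _×-dec_; toWitness)
open import Relation.Unary using (Pred; Decidable)

private variable
  A B : Set
  P Q R : Pred A 0ℓ
  n : ℕ

-- Counting in lists

Unique-resp-↭ : {xs ys : List A} → xs ↭ ys → Unique xs → Unique ys
Unique-resp-↭ p = ↭ₛ.Unique-resp-↭ (setoid _) (↭⇒↭ₛ p)

Unique-++⁻ : (xs : List A) {ys : List A} → Unique (xs ++ ys) →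
  Unique xs × Unique ys × (∀ {x} → x ∈ xs → x ∉ ys)
Unique-++⁻ []       u       = [] , u , λ ()
Unique-++⁻ (x ∷ xs) (d ∷ u) with Unique-++⁻ xs u
... | uxs , uys , disj = All.++⁻ˡ xs d ∷ uxs , uys , λ where
  (here refl) z∈ys → All.lookup (All.++⁻ʳ xs d) z∈ys refl
  (there z∈xs)     → disj z∈xs

length-filter-⊎ : (P? : Decidable P) (Q? : Decidable Q) (R? : Decidable R) →
  (∀ {x} → P x → Q x ⊎ R x) → (xs : List A) →
  length (filter P? xs) ≤ length (filter Q? xs) + length (filter R? xs)
length-filter-⊎ P? Q? R? f [] = z≤n
length-filter-⊎ P? Q? R? f (x ∷ xs) with P? x | Q? x | R? x | length-filter-⊎ P? Q? R? f xs
... | yes p | yes q | yes r | ih = s≤s (≤-trans ih (+-monoʳ-≤ _ (n≤1+n _)))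
... | yes p | yes q | no  r | ih = s≤s ih
... | yes p | no  q | yes r | ih = ≤-trans (s≤s ih) (≤-reflexive (sym (+-suc _ _)))
... | no  p | yes q | yes r | ih = ≤-trans ih (+-mono-≤ (n≤1+n _) (n≤1+n _))
... | no  p | yes q | no  r | ih = ≤-trans ih (n≤1+n _)
... | no  p | no  q | yes r | ih = ≤-trans ih (+-monoʳ-≤ _ (n≤1+n _))
... | no  p | no  q | no  r | ih = ih
... | yes p | no  q | no  r | ih with f p
...   | inj₁ q′ = contradiction q′ q
...   | inj₂ r′ = contradiction r′ r

length-filter-any : {C : A → B → Set} (C? : ∀ x y → Dec (C x y)) (ys : List B) {k : ℕ} →
  (xs : List A) → (∀ {x} → x ∈ xs → length (filter (C? x) ys) ≤ k) →
  length (filter (λ y → any? (λ x → C? x y) xs) ys) ≤ length xs * k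
length-filter-any C? ys [] h =
  ≤-reflexive (cong length (List.filter-none (λ y → any? (λ x → C? x y) []) (All.universal (λ _ ()) ys)))
length-filter-any C? ys (x ∷ xs) h = ≤-trans
  (length-filter-⊎ (λ y → any? (λ x → C? x y) (x ∷ xs)) (C? x) (λ y → any? (λ x → C? x y) xs)
    (λ { (here c) → inj₁ c ; (there c) → inj₂ c }) ys)
  (+-mono-≤ (h (here refl)) (length-filter-any C? ys xs (h ∘ there)))

length-filter-¬ : (P? : Decidable P) (xs : List A) →
  length (filter P? xs) + length (filter (¬? ∘ P?) xs) ≡ length xs
length-filter-¬ P? [] = refl
length-filter-¬ P? (x ∷ xs) with P? x
... | yes _ = cong suc (length-filter-¬ P? xs)
... | no  _ = trans (+-suc _ _) (cong suc (length-filter-¬ P? xs))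

length-filter-≤1 : (P? : Decidable P) {xs : List A} → Unique xs →
  (∀ {x y} → x ∈ xs → y ∈ xs → P x → P y → x ≡ y) → length (filter P? xs) ≤ 1
length-filter-≤1 P? [] h = z≤n
length-filter-≤1 P? {x ∷ xs} (d ∷ u) h with P? x
... | no  _ = length-filter-≤1 P? u (λ x∈ y∈ → h (there x∈) (there y∈))
... | yes p = s≤s (≤-reflexive (cong length (List.filter-none P?
  (All.tabulate λ y∈ q → All.lookup d y∈ (h (here refl) (there y∈) p q)))))

length-filter-↭-++ : (P? : Decidable P) {xs : List A} (ys : List A) {zs : List A} →
  xs ↭ ys ++ zs → length (filter P? zs) ≤ length (filter P? xs)
length-filter-↭-++ P? {xs} ys {zs} p = begin
  length (filter P? zs)                         ≤⟨ m≤n+m _ _ ⟩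
  length (filter P? ys) + length (filter P? zs) ≡⟨ List.length-++ (filter P? ys) ⟨
  length (filter P? ys ++ filter P? zs)         ≡⟨ cong length (List.filter-++ P? ys zs) ⟨
  length (filter P? (ys ++ zs))                 ≡⟨ ↭-length (filter-↭ P? p) ⟨
  length (filter P? xs)                         ∎
  where open ≤-Reasoning

sum-map-+ : (f g : A → ℕ) (xs : List A) →
  sum (map (λ x → f x + g x) xs) ≡ sum (map f xs) + sum (map g xs)
sum-map-+ f g [] = refl
sum-map-+ f g (x ∷ xs) rewrite sum-map-+ f g xs =
  solve 4 (λ a b c d → a :+ b :+ (c :+ d) := a :+ c :+ (b :+ d)) refl
    (f x) (g x) (sum (map f xs)) (sum (map g xs))
  where open ℕ-Solver

sum-map-0 : (xs : List A) → sum (map (λ _ → 0) xs) ≡ 0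
sum-map-0 []       = refl
sum-map-0 (_ ∷ xs) = sum-map-0 xs

module _ {K : A → B → Set} (K? : ∀ y z → Dec (K y z)) where

  length-filter-∷ : ∀ y z zs → length (filter (K? y) (z ∷ zs)) ≡
    length (filter (K? y) (z ∷ [])) + length (filter (K? y) zs)
  length-filter-∷ y z zs with does (K? y z)
  ... | true  = refl
  ... | false = refl

  sum-length-filter : ∀ ys z →
    sum (map (λ y → length (filter (K? y) (z ∷ []))) ys) ≡ length (filter (λ y → K? y z) ys)
  sum-length-filter [] z = refl
  sum-length-filter (y ∷ ys) z with does (K? y z)
  ... | true  = cong suc (sum-length-filter ys z)
  ... | false = sum-length-filter ys z

  -- The related pairs are counted by their second entry instead of their first: each `z`
  -- contributes its degree, at most `k`.
  double-counting : ∀ ys zs {k} → (∀ {z} → z ∈ zs → length (filter (λ y → K? y z) ys) ≤ k) →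
    sum (map (λ y → length (filter (K? y) zs)) ys) ≤ length zs * k
  double-counting ys [] h = ≤-reflexive (sum-map-0 ys)
  double-counting ys (z ∷ zs) {k} h = begin
    sum (map (λ y → length (filter (K? y) (z ∷ zs))) ys)
      ≡⟨ cong sum (List.map-cong (λ y → length-filter-∷ y z zs) ys) ⟩
    sum (map (λ y → length (filter (K? y) (z ∷ [])) + length (filter (K? y) zs)) ys)
      ≡⟨ sum-map-+ _ _ ys ⟩
    sum (map (λ y → length (filter (K? y) (z ∷ []))) ys) +
    sum (map (λ y → length (filter (K? y) zs)) ys)
      ≤⟨ +-mono-≤ (≤-trans (≤-reflexive (sum-length-filter ys z)) (h (here refl)))
                  (double-counting ys zs (h ∘ there)) ⟩
    k + length zs * k ∎
    where open ≤-Reasoning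

below-average : (f : A → ℕ) (x : A) (xs : List A) →
  ∃[ y ] (y ∈ x ∷ xs × length (x ∷ xs) * f y ≤ sum (map f (x ∷ xs)))
below-average f x [] = x , here refl , ≤-refl
below-average f x (x′ ∷ xs) with below-average f x′ xs
... | y , y∈ , h with ≤-total (f x) (f y)
...   | inj₁ fx≤fy = x , here refl ,
        +-monoʳ-≤ (f x) (≤-trans (*-monoʳ-≤ (length (x′ ∷ xs)) fx≤fy) h)
...   | inj₂ fy≤fx = y , there y∈ , +-mono-≤ fy≤fx h

∈⇒↭ : {x : A} {xs : List A} → x ∈ xs → ∃[ ys ] xs ↭ x ∷ ys
∈⇒↭ x∈xs with ∈-∃++ x∈xs
... | ys , zs , refl = ys ++ zs , ↭-shift _ ys zs

-- Greedy selection

module Greedy {K : A → B → Set} (K? : ∀ y z → Dec (K y z)) where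

  -- `ys` is the pool and `zs` the set of vertices still usable. Keeping `rest` lets a further
  -- selection continue from the leftover pool. A lower bound on `survivors` is not a field, since
  -- it differs from stage to stage.
  record Selection (ys : List A) (zs : List B) (t : ℕ) : Set where
    field
      chosen rest : List A
      survivors   : List B
      partition   : ys ↭ chosen ++ rest
      length≡     : length chosen ≡ t
      survivors⊆  : survivors ⊆ zs
      fewer       : length survivors ≤ length zs
      unique      : Unique zs → Unique survivors
      avoids      : ∀ {y z} → y ∈ chosen → z ∈ survivors → ¬ K y z

  open Selection

  Degree≤ : List A → List B → ℕ → Set
  Degree≤ ys zs k = ∀ {z} → z ∈ zs → length (filter (λ y → K? y z) ys) ≤ k

  nothing : ∀ {ys zs} → Selection ys zs 0
  nothing {ys} {zs} = record
    { chosen = [] ; rest = ys ; survivors = zs ; partition = ↭-refl ; length≡ = refl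
    ; survivors⊆ = id ; fewer = ≤-refl ; unique = id ; avoids = λ () }

  andThen : ∀ {ys zs s t} (S : Selection ys zs s) →
    Selection (rest S) (survivors S) t → Selection ys zs (s + t)
  andThen S T = record
    { chosen = chosen S ++ chosen T
    ; rest = rest T
    ; survivors = survivors T
    ; partition = ↭-trans (partition S) (↭-trans (++⁺ˡ (chosen S) (partition T))
        (↭-reflexive (sym (List.++-assoc (chosen S) (chosen T) (rest T)))))
    ; length≡ = trans (List.length-++ (chosen S)) (cong₂ _+_ (length≡ S) (length≡ T))
    ; survivors⊆ = survivors⊆ S ∘ survivors⊆ T
    ; fewer = ≤-trans (fewer T) (fewer S)
    ; unique = unique T ∘ unique S
    ; avoids = λ y∈ z∈ → avoid (∈-++⁻ (chosen S) y∈) z∈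
    }
    where
    avoid : ∀ {y z} → y ∈ chosen S ⊎ y ∈ chosen T → z ∈ survivors T → ¬ K y z
    avoid (inj₁ y∈) z∈ = avoids S y∈ (survivors⊆ T z∈)
    avoid (inj₂ y∈) z∈ = avoids T y∈ z∈

  -- Shrinking the pool or the set of targets raises no degree, so one `k` serves for all later
  -- choices.
  degree-rest : ∀ {ys zs t k} → Degree≤ ys zs k → (S : Selection ys zs t) →
    Degree≤ (rest S) (survivors S) k
  degree-rest h S z∈ = ≤-trans (length-filter-↭-++ _ (chosen S) (partition S)) (h (survivors⊆ S z∈))

  length-rest : ∀ {ys zs} t {d} (S : Selection ys zs t) → t + d ≤ length ys → d ≤ length (rest S)
  length-rest t {d} S h = +-cancelˡ-≤ t _ _ (≤-trans h (≤-reflexive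
    (trans (↭-length (partition S))
      (trans (List.length-++ (chosen S)) (cong (_+ length (rest S)) (length≡ S))))))

  -- Some `y` of at least average quality is related to at most the fraction `k / suc d` of `zs`;
  -- the inequality is this loss with denominators cleared. Bounding the pool below by `suc d` makes
  -- it nonempty and allows later cancellation.
  pick : ∀ {ys zs k} d → suc d ≤ length ys → Degree≤ ys zs k →
    ∃[ S ] suc d * length zs ≤ suc d * length (survivors {ys} {zs} {1} S) + k * length zs
  pick {y₀ ∷ ys₀} {zs} {k} d d< h
    with y , y∈ , avg ← below-average (λ y → length (filter (K? y) zs)) y₀ ys₀
    with ys′ , p ← ∈⇒↭ y∈ = record
    { chosen = y ∷ [] ; rest = ys′ ; survivors = filter (¬? ∘ K? y) zs
    ; partition = p ; length≡ = refl
    ; survivors⊆ = proj₁ ∘ ∈-filter⁻ (¬? ∘ K? y)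
    ; fewer = List.length-filter (¬? ∘ K? y) zs
    ; unique = Unique.filter⁺ (¬? ∘ K? y)
    ; avoids = λ { (here refl) z∈ → proj₂ (∈-filter⁻ (¬? ∘ K? y) {xs = zs} z∈) } } , (begin
    suc d * length zs
      ≡⟨ cong (suc d *_) (length-filter-¬ (K? y) zs) ⟨
    suc d * (length (filter (K? y) zs) + m)
      ≡⟨ *-distribˡ-+ (suc d) (length (filter (K? y) zs)) m ⟩
    suc d * length (filter (K? y) zs) + suc d * m
      ≤⟨ +-monoˡ-≤ (suc d * m) (≤-trans (*-monoˡ-≤ _ d<)
           (≤-trans avg (double-counting K? (y₀ ∷ ys₀) zs h))) ⟩
    length zs * k + suc d * m
      ≡⟨ trans (+-comm (length zs * k) (suc d * m)) (cong (λ x → suc d * m + x) (*-comm (length zs) k)) ⟩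
    suc d * m + k * length zs ∎)
    where
    open ≤-Reasoning
    m = length (filter (¬? ∘ K? y) zs)

  -- The set of targets only shrinks, so each choice loses at most `k / suc d` times its initial
  -- length, and `t` choices lose at most `t` times that. The pool keeps at least `suc d` elements
  -- throughout.
  pickMany : ∀ {ys zs k} d t → t + suc d ≤ length ys → Degree≤ ys zs k →
    ∃[ S ] suc d * length zs ≤ suc d * length (survivors {ys} {zs} {t} S) + t * (k * length zs)
  pickMany d zero _ _ = nothing , m≤m+n _ _
  pickMany {ys} {zs} {k} d (suc t) l h
    with S , hS ← pick d (≤-trans (m≤n+m _ (suc t)) l) h
    with T , hT ← pickMany d t (length-rest 1 S l) (degree-rest h S) = andThen S T , (begin
    suc d * length zs
      ≤⟨ hS ⟩
    suc d * length (survivors S) + k * length zs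
      ≤⟨ +-monoˡ-≤ (k * length zs) hT ⟩
    suc d * length (survivors T) + t * (k * length (survivors S)) + k * length zs
      ≤⟨ +-monoˡ-≤ (k * length zs) (+-monoʳ-≤ (suc d * length (survivors T))
           (*-monoʳ-≤ t (*-monoʳ-≤ k (fewer S)))) ⟩
    suc d * length (survivors T) + t * (k * length zs) + k * length zs
      ≡⟨ solve 3 (λ a b c → a :+ b :+ c := a :+ (c :+ b)) refl
           (suc d * length (survivors T)) (t * (k * length zs)) (k * length zs) ⟩
    suc d * length (survivors T) + (k * length zs + t * (k * length zs)) ∎)
    where
    open ≤-Reasoning
    open ℕ-Solver

  halve : ∀ {ys zs k} d t → t + suc d ≤ length ys → Degree≤ ys zs k → 2 * (t * k) ≤ suc d →
    ∃[ S ] length zs ≤ 2 * length (survivors {ys} {zs} {t} S)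
  halve {ys} {zs} {k} d t l h 2tk≤d with S , hS ← pickMany d t l h = S ,
    -- Twice the inequality of `pickMany` has the loss `2 * (t * k) * m ≤ suc d * m`, which cancels
    -- one of the two copies on the left.
    *-cancelˡ-≤ (suc d) (+-cancelʳ-≤ (suc d * m) _ _ (begin
      suc d * m + suc d * m
        ≤⟨ +-mono-≤ hS hS ⟩
      suc d * m′ + t * (k * m) + (suc d * m′ + t * (k * m))
        ≡⟨ solve 5 (λ d m m′ t k → d :* m′ :+ t :* (k :* m) :+ (d :* m′ :+ t :* (k :* m))
             := d :* (con 2 :* m′) :+ con 2 :* (t :* k) :* m) refl (suc d) m m′ t k ⟩
      suc d * (2 * m′) + 2 * (t * k) * m
        ≤⟨ +-monoʳ-≤ (suc d * (2 * m′)) (*-monoˡ-≤ m 2tk≤d) ⟩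
      suc d * (2 * m′) + suc d * m ∎))
    where
    open ≤-Reasoning
    open ℕ-Solver
    m = length zs
    m′ = length (survivors S)

  -- Each round is measured against the survivors of the round before, so the factors 2 multiply.
  -- The surplus `suc d` in the pool is what every round averages over.
  halveRepeatedly : ∀ {ys zs k} d t c → c * t + suc d ≤ length ys → Degree≤ ys zs k →
    2 * (t * k) ≤ suc d → ∃[ S ] length zs ≤ 2 ^ c * length (survivors {ys} {zs} {c * t} S)
  halveRepeatedly d t zero _ _ _ = nothing , ≤-reflexive (sym (*-identityˡ _))
  halveRepeatedly {ys} {zs} d t (suc c) l h e =
    andThen (proj₁ S) (proj₁ T) , (begin
      length zs                                         ≤⟨ proj₂ S ⟩
      2 * length (survivors (proj₁ S))                  ≤⟨ *-monoʳ-≤ 2 (proj₂ T) ⟩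
      2 * (2 ^ c * length (survivors (proj₁ T)))        ≡⟨ *-assoc 2 (2 ^ c) (length (survivors (proj₁ T))) ⟨
      2 ^ suc c * length (survivors (proj₁ T))          ∎)
    where
    open ≤-Reasoning
    l′ : t + (c * t + suc d) ≤ length ys
    l′ = subst (_≤ length ys) (+-assoc t (c * t) (suc d)) l
    S = halve d t (≤-trans (+-monoʳ-≤ t (m≤n+m (suc d) (c * t))) l′) h e
    T = halveRepeatedly d t c (length-rest t (proj₁ S) l′) (degree-rest h (proj₁ S)) e

-- Lists of vertices as subsets

∈-tabulate⁻ : (P? : Decidable P) {x : Fin n} → x Subset.∈ Vec.tabulate (does ∘ P?) → P x
∈-tabulate⁻ P? {x} x∈ with trans (sym (Vec.lookup∘tabulate (does ∘ P?) x)) (Vec.[]=⇒lookup x∈)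
... | e with P? x | e
...   | yes p | _ = p

∈-tabulate⁺ : (P? : Decidable P) {x : Fin n} → P x → x Subset.∈ Vec.tabulate (does ∘ P?)
∈-tabulate⁺ P? {x} p = Vec.lookup⇒[]= x _
  (trans (Vec.lookup∘tabulate (does ∘ P?) x) (dec-true (P? x) p))

toSubset : List (Fin n) → Subset n
toSubset xs = Vec.tabulate λ x → does (member? Fin._≟_ x xs)

length≤card : {xs : List (Fin n)} {p : Subset n} → Unique xs →
  (∀ {x} → x ∈ xs → x Subset.∈ p) → length xs ≤ card p
length≤card [] h = z≤n
length≤card (d ∷ u) h = ≤-<-trans
  (length≤card u λ y∈ → Subset.x∈p∧x≢y⇒x∈p-y (h (there y∈)) (≢-sym (All.lookup d y∈)))
  (Subset.x∈p⇒∣p-x∣<∣p∣ (h (here refl)))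

subsetOfSize : (p : Subset n) {a : ℕ} → a ≤ card p → ∃[ q ] (q Subset.⊆ p × card q ≡ a)
subsetOfSize {n} p {zero} _ = Subset.⊥ , Subset.⊆-min p , Subset.∣⊥∣≡0 n
subsetOfSize (outside ∷ p) {suc a} h with q , q⊆p , e ← subsetOfSize p h =
  outside ∷ q , Subset.s⊆s q⊆p , e
subsetOfSize (inside ∷ p) {suc a} h with q , q⊆p , e ← subsetOfSize p (≤-pred h) =
  inside ∷ q , Subset.s⊆s q⊆p , cong suc e

disjoint-card : (p q : Subset n) {a : ℕ} → Empty (p ∩ q) → card q ≡ a → card p + a ≤ n
disjoint-card {n} p q e refl = begin
  card p + card q             ≤⟨ +-monoˡ-≤ (card q) (Subset.p⊆q⇒∣p∣≤∣q∣ λ {x} x∈p →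
                                   Subset.x∉p⇒x∈∁p λ x∈q → e (x , Subset.x∈p∩q⁺ (x∈p , x∈q))) ⟩
  card (Subset.∁ q) + card q  ≡⟨ cong (_+ card q) (Subset.∣∁p∣≡n∸∣p∣ q) ⟩
  n ∸ card q + card q         ≡⟨ m∸n+n≡m (Subset.∣p∣≤n q) ⟩
  n                           ∎
  where open ≤-Reasoning

splitFin : ∀ p q {r} → p + (q + r) ≤ n → ∃[ xs ] ∃[ ys ] ∃[ zs ]
  (Unique {A = Fin n} (xs ++ (ys ++ zs)) × length xs ≡ p × length ys ≡ q × r ≤ length zs)
splitFin {n} p q {r} h = take p V , take q V′ , drop q V′ ,
  subst Unique (sym (trans (cong (take p V ++_) (List.take++drop≡id q V′)) (List.take++drop≡id p V)))
    (Unique.allFin⁺ n) ,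
  trans (List.length-take p V) (m≤n⇒m⊓n≡m (subst (p ≤_) (sym |V|) (≤-trans (m≤m+n p _) h))) ,
  trans (List.length-take q V′) (m≤n⇒m⊓n≡m (≤-trans (m≤m+n q r) |V′|)) ,
  subst (r ≤_) (sym (List.length-drop q V′)) (≤-∸ q |V′|)
  where
  V = allFin n
  ≤-∸ : ∀ a {b c} → a + b ≤ c → b ≤ c ∸ a
  ≤-∸ a {b} {c} a+b≤c = m+n≤o⇒m≤o∸n b (subst (_≤ c) (+-comm a b) a+b≤c)
  V′ = drop p V
  |V| : length V ≡ n
  |V| = List.length-tabulate id
  |V′| : q + r ≤ length V′
  |V′| = subst (q + r ≤_) (trans (cong (_∸ p) (sym |V|)) (sym (List.length-drop p V)))
    (≤-∸ p h)

-- Steiner triple systems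

module _ {n : ℕ} (H : Hypergraph n) where
  open Hypergraph H

  Collinear : Fin n → Fin n → Fin n → Set
  Collinear x y z = ∃[ j ] (x Subset.∈ edge j × y Subset.∈ edge j × z Subset.∈ edge j)

  collinear? : ∀ x y z → Dec (Collinear x y z)
  collinear? x y z = Fin.any? λ j →
    (x Subset.∈? edge j) ×-dec (y Subset.∈? edge j) ×-dec (z Subset.∈? edge j)

  collinear-rotate : ∀ {x y z} → Collinear x y z → Collinear x z y
  collinear-rotate (j , x∈ , y∈ , z∈) = j , x∈ , z∈ , y∈

  -- The lists may be longer than `a`; each is cut down to a subset of exactly `a` elements. An edge
  -- meeting all three subsets would contain a forbidden collinear triple.
  tripleOfSize : ∀ {a xs ys zs} → Unique xs → Unique ys → Unique zs →
    a ≤ length xs → a ≤ length ys → a ≤ length zs →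
    (∀ {x} → x ∈ xs → x ∉ ys) → (∀ {x} → x ∈ xs → x ∉ zs) → (∀ {y} → y ∈ ys → y ∉ zs) →
    (∀ {x y z} → x ∈ xs → y ∈ ys → z ∈ zs → ¬ Collinear x y z) → TripleOfSize H a
  tripleOfSize {a} {xs} {ys} {zs} ux uy uz lx ly lz xy xz yz none =
    X , Y , Z , (cardX , cardY , cardZ) ,
    (disjoint X Y X⊆ Y⊆ xy , disjoint X Z X⊆ Z⊆ xz , disjoint Y Z Y⊆ Z⊆ yz) , misses
    where
    represent : ∀ {vs} → Unique vs → a ≤ length vs →
      ∃[ q ] ((∀ {v} → v Subset.∈ q → v ∈ vs) × card q ≡ a)
    represent {vs} u l with q , q⊆ , e ← subsetOfSize (toSubset vs)
        (≤-trans l (length≤card u (∈-tabulate⁺ (λ x → member? Fin._≟_ x vs)))) =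
      q , ∈-tabulate⁻ (λ x → member? Fin._≟_ x vs) ∘ q⊆ , e
    RX = represent ux lx
    RY = represent uy ly
    RZ = represent uz lz
    X = proj₁ RX
    Y = proj₁ RY
    Z = proj₁ RZ
    X⊆ : ∀ {v} → v Subset.∈ X → v ∈ xs
    X⊆ = proj₁ (proj₂ RX)
    Y⊆ : ∀ {v} → v Subset.∈ Y → v ∈ ys
    Y⊆ = proj₁ (proj₂ RY)
    Z⊆ : ∀ {v} → v Subset.∈ Z → v ∈ zs
    Z⊆ = proj₁ (proj₂ RZ)
    cardX = proj₂ (proj₂ RX)
    cardY = proj₂ (proj₂ RY)
    cardZ = proj₂ (proj₂ RZ)
    disjoint : ∀ p q {us vs} → (∀ {v} → v Subset.∈ p → v ∈ us) → (∀ {v} → v Subset.∈ q → v ∈ vs) →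
      (∀ {v} → v ∈ us → v ∉ vs) → Empty (p ∩ q)
    disjoint p q f g d (v , v∈) with v∈p , v∈q ← Subset.x∈p∩q⁻ p q v∈ = d (f v∈p) (g v∈q)
    misses : ∀ j → Empty (edge j ∩ X) ⊎ Empty (edge j ∩ Y) ⊎ Empty (edge j ∩ Z)
    misses j with empty? (edge j ∩ X) | empty? (edge j ∩ Y) | empty? (edge j ∩ Z)
    ... | yes e | _ | _ = inj₁ e
    ... | no _ | yes e | _ = inj₂ (inj₁ e)
    ... | no _ | no _ | yes e = inj₂ (inj₂ e)
    ... | no ¬x | no ¬y | no ¬z = contradiction (meets X ¬x) λ (x , x∈j , x∈X) →
      contradiction (meets Y ¬y) λ (y , y∈j , y∈Y) →
      contradiction (meets Z ¬z) λ (z , z∈j , z∈Z) →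
      none (X⊆ x∈X) (Y⊆ y∈Y) (Z⊆ z∈Z) (j , x∈j , y∈j , z∈j)
      where
      meets : ∀ p → ¬ Empty (edge j ∩ p) → ∃[ x ] (x Subset.∈ edge j × x Subset.∈ p)
      -- `Empty` is a negation, so a witness is obtained by deciding nonemptiness.
      meets p ¬e with Subset.nonempty? (edge j ∩ p)
      ... | yes (x , x∈) = x , Subset.x∈p∩q⁻ (edge j) p x∈
      ... | no ¬ne = contradiction ¬ne ¬e

  module _ (sts : SteinerTripleSystem H) where

    -- Both triples lie on the only edge through `x` and `y`; if `z` and `z′` differed, this edge
    -- would have four vertices.
    collinear-unique : ∀ {x y z z′} → x ≢ y → x ≢ z → y ≢ z → x ≢ z′ → y ≢ z′ →
      Collinear x y z → Collinear x y z′ → z ≡ z′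
    collinear-unique {x} {y} {z} {z′} x≢y x≢z y≢z x≢z′ y≢z′ (j , x∈ , y∈ , z∈) (j′ , x∈′ , y∈′ , z∈′)
      with i , _ , uniq ← proj₂ sts x y x≢y
      with refl ← trans (sym (uniq (x∈ , y∈))) (uniq (x∈′ , y∈′))
      with z Fin.≟ z′
    ... | yes e = e
    ... | no z≢z′ = contradiction (subst (4 ≤_) (proj₁ sts j) (length≤card
      {xs = x ∷ y ∷ z ∷ z′ ∷ []}
      ((x≢y ∷ x≢z ∷ x≢z′ ∷ []) ∷ (y≢z ∷ y≢z′ ∷ []) ∷ (z≢z′ ∷ []) ∷ [] ∷ [])
      λ { (here refl) → x∈ ; (there (here refl)) → y∈ ; (there (there (here refl))) → z∈
        ; (there (there (there (here refl)))) → z∈′ })) λ { (s≤s (s≤s (s≤s ()))) }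

    module _ (xs ys zs : List (Fin n)) (u : Unique (xs ++ (ys ++ zs))) where
      private
        U₁ = Unique-++⁻ xs u
        U₂ = Unique-++⁻ ys (proj₁ (proj₂ U₁))
        ux : Unique xs
        ux = proj₁ U₁
        uy : Unique ys
        uy = proj₁ U₂
        uz : Unique zs
        uz = proj₁ (proj₂ U₂)
        xy : ∀ {x} → x ∈ xs → x ∉ ys
        xy x∈ y∈ = proj₂ (proj₂ U₁) x∈ (∈-++⁺ˡ y∈)
        xz : ∀ {x} → x ∈ xs → x ∉ zs
        xz x∈ z∈ = proj₂ (proj₂ U₁) x∈ (∈-++⁺ʳ ys z∈)
        yz : ∀ {y} → y ∈ ys → y ∉ zs
        yz = proj₂ (proj₂ U₂)

        apart : ∀ {us vs : List (Fin n)} {v w} → (∀ {x} → x ∈ us → x ∉ vs) → v ∈ us → w ∈ vs → v ≢ w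
        apart d v∈ w∈ refl = d v∈ w∈

        Joined : Fin n → Fin n → Set
        Joined y z = Any (λ x → Collinear x y z) xs

        joined? : ∀ y z → Dec (Joined y z)
        joined? y z = any? (λ x → collinear? x y z) xs

        open Greedy joined?
        open Selection

        -- For each vertex of `xs`, at most one `z` completes it and `y` to an edge.
        joined-zs : ∀ {y} → y ∈ ys → length (filter (joined? y) zs) ≤ length xs * 1
        joined-zs {y} y∈ = length-filter-any (λ x z → collinear? x y z) zs xs λ {x} x∈ →
          length-filter-≤1 (collinear? x y) uz λ z∈ z′∈ → collinear-unique (apart xy x∈ y∈)
            (apart xz x∈ z∈) (apart yz y∈ z∈) (apart xz x∈ z′∈) (apart yz y∈ z′∈)

        -- The degree bound for the greedy selection: a vertex of `xs` and `z` determine at most one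
        -- `y`.
        joined-ys : ∀ {z} → z ∈ zs → length (filter (λ y → joined? y z) ys) ≤ length xs * 1
        joined-ys {z} z∈ = length-filter-any (λ x y → collinear? x y z) ys xs λ {x} x∈ →
          length-filter-≤1 (λ y → collinear? x y z) uy λ y∈ y′∈ c c′ → collinear-unique
            (apart xz x∈ z∈) (apart xy x∈ y∈) (≢-sym (apart yz y∈ z∈))
            (apart xy x∈ y′∈) (≢-sym (apart yz y′∈ z∈)) (collinear-rotate c) (collinear-rotate c′)

      -- Every `z` joined to some `y` is discarded. Each of the `a` vertices of `ys` rules out at
      -- most `a` of them, so at least `a` remain.
      tripleOfSize-direct : ∀ {a} → length xs ≡ a → length ys ≡ a → a * a + a ≤ length zs →
        TripleOfSize H a
      tripleOfSize-direct {a} refl ly lz = tripleOfSize ux uy (Unique.filter⁺ (¬? ∘ bad?) uz)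
        ≤-refl (≤-reflexive (sym ly)) large xy (λ x∈ z∈ → xz x∈ (kept z∈)) (λ y∈ z∈ → yz y∈ (kept z∈))
        (λ x∈ y∈ z∈ c → proj₂ (∈-filter⁻ (¬? ∘ bad?) {xs = zs} z∈)
          (Any.map (λ { refl → Any.map (λ { refl → c }) x∈ }) y∈))
        where
        bad? : ∀ z → Dec (Any (λ y → Joined y z) ys)
        bad? z = any? (λ y → joined? y z) ys
        kept : ∀ {z} → z ∈ filter (¬? ∘ bad?) zs → z ∈ zs
        kept z∈ = proj₁ (∈-filter⁻ (¬? ∘ bad?) z∈)
        few : length (filter bad? zs) ≤ a * a
        few = ≤-trans (length-filter-any joined? zs ys joined-zs)
          (≤-reflexive (cong₂ _*_ ly (*-identityʳ a)))
        large : a ≤ length (filter (¬? ∘ bad?) zs)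
        large = +-cancelˡ-≤ (a * a) _ _ (≤-trans lz (≤-trans
          (≤-reflexive (sym (length-filter-¬ bad? zs))) (+-monoˡ-≤ _ few)))

      -- The second set is formed by the `c * t` chosen vertices. The `c` halvings leave at least
      -- `a` of the `2 ^ c * a` candidates for the third set.
      tripleOfSize-greedy : ∀ {a} d t c → length xs ≡ a → c * t + suc d ≤ length ys →
        2 * (t * a) ≤ suc d → a ≤ c * t → 2 ^ c * a ≤ length zs → TripleOfSize H a
      tripleOfSize-greedy {a} d t c refl ly 2ta≤d a≤ct lz
        with S , hS ← halveRepeatedly {ys} {zs} d t c ly joined-ys
               (subst (λ k → 2 * (t * k) ≤ suc d) (sym (*-identityʳ a)) 2ta≤d)
        = tripleOfSize ux (proj₁ (Unique-++⁻ (chosen S) (Unique-resp-↭ (partition S) uy)))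
            (unique S uz)
            ≤-refl (≤-trans a≤ct (≤-reflexive (sym (length≡ S))))
            (*-cancelˡ-≤ (2 ^ c) {{m^n≢0 2 c}} (≤-trans lz hS))
            (λ x∈ y∈ → xy x∈ (chosen⊆ y∈)) (λ x∈ z∈ → xz x∈ (survivors⊆ S z∈))
            (λ y∈ z∈ → yz (chosen⊆ y∈) (survivors⊆ S z∈))
            (λ x∈ y∈ z∈ c → avoids S y∈ z∈ (Any.map (λ { refl → c }) x∈))
        where
        chosen⊆ : ∀ {y} → y ∈ chosen S → y ∈ ys
        chosen⊆ y∈ = ∈-resp-↭ (↭-sym (partition S)) (∈-++⁺ˡ y∈)

    direct : ∀ a → a + (a + (a * a + a)) ≤ n → TripleOfSize H a
    direct a h with xs , ys , zs , u , lx , ly , lz ← splitFin a a h =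
      tripleOfSize-direct xs ys zs u lx ly lz

    greedy : ∀ a d t c → a + ((c * t + suc d) + 2 ^ c * a) ≤ n →
      2 * (t * a) ≤ suc d → a ≤ c * t → TripleOfSize H a
    greedy a d t c h h₁ h₂ with xs , ys , zs , u , lx , ly , lz ← splitFin a (c * t + suc d) h =
      tripleOfSize-greedy xs ys zs u d t c lx (≤-reflexive (sym ly)) h₁ h₂ lz

-- Choice of the parameters

greatest-spec : {P : ℕ → Set} (P? : Decidable P) (b : ℕ) → P 0 → (∀ {k} → P k → k ≤ b) →
  ∃[ g ] (P g × ¬ P (suc g))
greatest-spec P? b p₀ bounded = greatest P? b , greatest-satisfies P? b p₀ ,
  λ p → 1+n≰n (greatest-upper P? (bounded p) p)

-- The default value 0 lies below every `k`, so only actual solutions matter.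
greatest-least : {P : ℕ → Set} (P? : Decidable P) (b : ℕ) {k : ℕ} → (∀ {m} → P m → m ≤ k) →
  greatest P? b ≤ k
greatest-least P? zero h = z≤n
greatest-least P? (suc b) h with P? (suc b)
... | yes p = h p
... | no  _ = greatest-least P? b h

square-cancel : ∀ {x y} → x * x ≤ y * y → x ≤ y
square-cancel h = ≮⇒≥ λ y<x → ≤⇒≯ h (*-mono-< y<x y<x)

n≤16^n : ∀ n → n ≤ 16 ^ n
n≤16^n zero = z≤n
n≤16^n (suc n) = begin
  1 + n            ≤⟨ +-mono-≤ (>-nonZero⁻¹ (16 ^ n) {{m^n≢0 16 n}}) (n≤16^n n) ⟩
  16 ^ n + 16 ^ n  ≤⟨ +-monoʳ-≤ (16 ^ n) (m≤m+n (16 ^ n) (14 * 16 ^ n)) ⟩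
  16 ^ suc n       ∎
  where
  open ≤-Reasoning

-- The upper exponent is lowered until `n` exceeds the next power; `suc (i + k)` is then log₁₆ n
-- rounded up.
bracket : ∀ {n} i j → 16 ^ i < n → n ≤ 16 ^ (i + j) →
  ∃[ k ] (16 ^ (i + k) < n × n ≤ 16 ^ suc (i + k))
bracket i zero lo hi = contradiction (subst (λ i → _ ≤ 16 ^ i) (+-identityʳ i) hi) (<⇒≱ lo)
bracket {n} i (suc j) lo hi with n ≤? 16 ^ (i + j)
... | yes n≤ = bracket i j lo n≤
... | no  n≰ = j , ≰⇒> n≰ , subst (λ i → n ≤ 16 ^ i) (+-suc i j) hi

-- With `c = 4 + k` and `p = 2 ^ (3 + k)` this is `8 * c ≤ p * p`, used to fit `8 * (p * a)` below
-- `n`.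
linear≤4^ : ∀ k → 8 * (4 + k) ≤ 2 ^ (3 + k) * 2 ^ (3 + k)
linear≤4^ zero = toWitness {a? = 32 ≤? 64} _
linear≤4^ (suc k) = begin
  8 * (5 + k)
    ≤⟨ m≤m+n _ (88 + 24 * k) ⟩
  8 * (5 + k) + (88 + 24 * k)
    ≡⟨ solve 1 (λ k → con 8 :* (con 5 :+ k) :+ (con 88 :+ con 24 :* k)
         := con 4 :* (con 8 :* (con 4 :+ k))) refl k ⟩
  4 * (8 * (4 + k))
    ≤⟨ *-monoʳ-≤ 4 (linear≤4^ k) ⟩
  4 * (p * p)
    ≡⟨ solve 1 (λ p → con 4 :* (p :* p) := con 2 :* p :* (con 2 :* p)) refl p ⟩
  2 * p * (2 * p) ∎
  where
  open ≤-Reasoning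
  open ℕ-Solver
  p = 2 ^ (3 + k)

16^≡ : ∀ k → 16 ^ k ≡ 2 ^ k * 2 ^ k * (2 ^ k * 2 ^ k)
16^≡ zero = refl
16^≡ (suc k) rewrite 16^≡ k =
  solve 1 (λ p → con 16 :* (p :* p :* (p :* p))
    := con 2 :* p :* (con 2 :* p) :* (con 2 :* p :* (con 2 :* p))) refl (2 ^ k)
  where open ℕ-Solver

-- `n≤2^L` makes `L` an upper bound for log n. The constant 50 satisfies 50 (0.417/3)² ≤ 1, so
-- `nL≤50a²` makes `a` large enough. The last three fields are the numerical hypotheses of `greedy`.
record Parameters (n : ℕ) : Set where
  field
    a d t c L : ℕ
    n≤2^L     : n ≤ 2 ^ L
    nL≤50a²   : n * L ≤ 50 * (a * a)
    fits      : a + ((c * t + suc d) + 2 ^ c * a) ≤ n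
    halving   : 2 * (t * a) ≤ suc d
    enough    : a ≤ c * t

module Large {n : ℕ} (lo : 16 ^ 3 < n) where
  open ≤-Reasoning
  open ℕ-Solver

  private
    bracketed = bracket 3 n lo (≤-trans (n≤16^n n) (^-monoʳ-≤ 16 (m≤n+m n 3)))
    k = proj₁ bracketed
    -- `c` is log₁₆ n rounded up, so `4 * c` bounds log₂ n; moreover `2 ^ c = 2 * p`, and the fourth
    -- power of `p` is below `n`.
    c = 4 + k
    p = 2 ^ (3 + k)

    -- `a` is √(nc/8) rounded down, about √(n log₂ n / 32).
    largest = greatest-spec (λ a → 8 * (a * a) ≤? n * c) (n * c) z≤n
      λ {a} h → ≤-trans (≤-trans (m≤m*m a) (m≤n*m (a * a) 8)) h
      where
      m≤m*m : ∀ m → m ≤ m * m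
      m≤m*m zero    = z≤n
      m≤m*m (suc m) = m≤m*n (suc m) (suc m)
    a = proj₁ largest

    8a²≤nc : 8 * (a * a) ≤ n * c
    8a²≤nc = proj₁ (proj₂ largest)

    nc<8[1+a]² : n * c < 8 * (suc a * suc a)
    nc<8[1+a]² = ≰⇒> (proj₂ (proj₂ largest))

    4≤a : 4 ≤ a
    4≤a = ≮⇒≥ λ a<4 → <⇒≱ lo (begin
      n                   ≤⟨ m≤m*n n c ⟩
      n * c               ≤⟨ <⇒≤ nc<8[1+a]² ⟩
      8 * (suc a * suc a) ≤⟨ *-monoʳ-≤ 8 (*-mono-≤ a<4 a<4) ⟩
      128                 ≤⟨ toWitness {a? = 128 ≤? 16 ^ 3} _ ⟩
      16 ^ 3              ∎)
    -- Substituting `4 + a′` for `a` turns quadratic inequalities valid for `4 ≤ a` into identities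
    -- with an explicit nonnegative remainder.
    a′ = a ∸ 4
    a≡ : 4 + a′ ≡ a
    a≡ = m+[n∸m]≡n 4≤a

    -- After squaring: 64p²a² ≤ 8p²nc ≤ np⁴, and p⁴ = 16^(3+k) < n.
    8pa≤n : 8 * (p * a) ≤ n
    8pa≤n = square-cancel (begin
      8 * (p * a) * (8 * (p * a))
        ≡⟨ solve 2 (λ p a → con 8 :* (p :* a) :* (con 8 :* (p :* a))
             := con 8 :* (p :* p) :* (con 8 :* (a :* a))) refl p a ⟩
      8 * (p * p) * (8 * (a * a))
        ≤⟨ *-monoʳ-≤ (8 * (p * p)) 8a²≤nc ⟩
      8 * (p * p) * (n * c)
        ≡⟨ solve 3 (λ q n c → con 8 :* q :* (n :* c) := n :* (q :* (con 8 :* c))) refl (p * p) n c ⟩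
      n * (p * p * (8 * c))
        ≤⟨ *-monoʳ-≤ n (*-monoʳ-≤ (p * p) (linear≤4^ k)) ⟩
      n * (p * p * (p * p))
        ≡⟨ cong (n *_) (16^≡ (3 + k)) ⟨
      n * 16 ^ (3 + k)
        ≤⟨ *-monoʳ-≤ n (<⇒≤ (proj₁ (proj₂ bracketed))) ⟩
      n * n ∎)

    -- `t` is n/(4a) rounded down, so the reserve `2 * (t * a)` takes at most half of the vertices.
    steps = greatest-spec (λ t → 4 * (a * t) ≤? n) n
      (subst (λ x → 4 * x ≤ n) (sym (*-zeroʳ a)) z≤n)
      λ {t} h → ≤-trans (≤-trans (subst (λ x → t ≤ x * t) a≡ (m≤n*m t (4 + a′))) (m≤n*m (a * t) 4)) h
    t = proj₁ steps

    4at≤n : 4 * (a * t) ≤ n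
    4at≤n = proj₁ (proj₂ steps)

    n<4a[1+t] : n < 4 * (a * suc t)
    n<4a[1+t] = ≰⇒> (proj₂ (proj₂ steps))

    8≤p : 8 ≤ p
    8≤p = ^-monoʳ-≤ 2 {3} {3 + k} (m≤m+n 3 k)

    1≤t : 1 ≤ t
    1≤t = ≮⇒≥ λ t<1 → <⇒≱ n<4a[1+t] (begin
      4 * (a * suc t)  ≤⟨ *-monoʳ-≤ 4 (*-monoʳ-≤ a t<1) ⟩
      4 * (a * 1)      ≡⟨ solve 1 (λ a → con 4 :* (a :* con 1) := con 4 :* a) refl a ⟩
      4 * a            ≤⟨ *-mono-≤ (m≤m+n 4 4) (≤-trans (m≤n*m a 8) (*-monoˡ-≤ a 8≤p)) ⟩
      8 * (p * a)      ≤⟨ 8pa≤n ⟩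
      n                ∎)

    -- From `1 ≤ t` follows n < 4a(1+t) ≤ 8at; together with 8a² ≤ nc this gives the claim
    -- multiplied by 8a.
    a≤ct : a ≤ c * t
    a≤ct = *-cancelˡ-≤ (8 * (4 + a′)) (subst (λ x → 8 * x * a ≤ 8 * x * (c * t)) (sym a≡) (begin
      8 * a * a              ≡⟨ *-assoc 8 a a ⟩
      8 * (a * a)            ≤⟨ 8a²≤nc ⟩
      n * c                  ≤⟨ *-monoˡ-≤ c (<⇒≤ n<4a[1+t]) ⟩
      4 * (a * suc t) * c    ≤⟨ *-monoˡ-≤ c (*-monoʳ-≤ 4 (*-monoʳ-≤ a (+-monoˡ-≤ t 1≤t))) ⟩
      4 * (a * (t + t)) * c  ≡⟨ solve 3 (λ a t c → con 4 :* (a :* (t :+ t)) :* c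
                                  := con 8 :* a :* (c :* t)) refl a t c ⟩
      8 * a * (c * t)        ∎))

    -- Otherwise 16a² ≤ 4a·ct ≤ nc < 8(1+a)², which is impossible for `4 ≤ a`.
    ct≤4a : c * t ≤ 4 * a
    ct≤4a = ≮⇒≥ λ 4a<ct → <⇒≱ nc<8[1+a]² (begin
      8 * (suc a * suc a)
        ≡⟨ cong (λ a → 8 * (suc a * suc a)) a≡ ⟨
      8 * ((5 + a′) * (5 + a′))
        ≤⟨ m≤m+n _ (56 + 48 * a′ + 8 * (a′ * a′)) ⟩
      8 * ((5 + a′) * (5 + a′)) + (56 + 48 * a′ + 8 * (a′ * a′))
        ≡⟨ solve 1 (λ a → con 8 :* ((con 5 :+ a) :* (con 5 :+ a)) :+ (con 56 :+ con 48 :* a :+ con 8 :* (a :* a))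
             := con 4 :* (con 4 :+ a) :* (con 4 :* (con 4 :+ a))) refl a′ ⟩
      4 * (4 + a′) * (4 * (4 + a′))
        ≡⟨ cong (λ a → 4 * a * (4 * a)) a≡ ⟩
      4 * a * (4 * a)
        ≤⟨ *-monoʳ-≤ (4 * a) (<⇒≤ 4a<ct) ⟩
      4 * a * (c * t)
        ≡⟨ solve 3 (λ a t c → con 4 :* a :* (c :* t) := con 4 :* (a :* t) :* c) refl a t c ⟩
      4 * (a * t) * c
        ≤⟨ *-monoˡ-≤ c 4at≤n ⟩
      n * c ∎)

    fits′ : a + ((c * t + suc (2 * (t * a))) + 2 ^ c * a) ≤ n
    fits′ = *-cancelˡ-≤ 2 (begin
      2 * (a + ((c * t + suc (2 * (t * a))) + 2 * p * a))
        ≡⟨ solve 4 (λ a t p x → con 2 :* (a :+ ((x :+ (con 1 :+ con 2 :* (t :* a))) :+ con 2 :* p :* a))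
             := con 4 :* (a :* t) :+ (con 2 :* a :+ con 2 :+ con 2 :* x :+ con 4 :* (p :* a))) refl a t p (c * t) ⟩
      4 * (a * t) + (2 * a + 2 + 2 * (c * t) + 4 * (p * a))
        -- Beyond `4 * (a * t)`, the doubled sum is at most 11a + 4pa. Padding 11a to 32a and using
        -- `8 ≤ p` bounds this by 8pa, hence by `n`.
        ≤⟨ +-mono-≤ 4at≤n (+-monoˡ-≤ (4 * (p * a)) (+-mono-≤ (+-monoʳ-≤ (2 * a)
             (≤-trans (m≤m+n 2 2) 4≤a)) (*-monoʳ-≤ 2 ct≤4a))) ⟩
      n + (2 * a + a + 2 * (4 * a) + 4 * (p * a))
        ≤⟨ +-monoʳ-≤ n (+-monoˡ-≤ (4 * (p * a)) (m≤m+n (2 * a + a + 2 * (4 * a)) (21 * a))) ⟩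
      n + (2 * a + a + 2 * (4 * a) + 21 * a + 4 * (p * a))
        ≡⟨ solve 3 (λ a p n → n :+ (con 2 :* a :+ a :+ con 2 :* (con 4 :* a) :+ con 21 :* a :+ con 4 :* (p :* a))
             := n :+ (con 4 :* (con 8 :* a) :+ con 4 :* (p :* a))) refl a p n ⟩
      n + (4 * (8 * a) + 4 * (p * a))
        ≤⟨ +-monoʳ-≤ n (+-monoˡ-≤ (4 * (p * a)) (*-monoʳ-≤ 4 (*-monoˡ-≤ a 8≤p))) ⟩
      n + (4 * (p * a) + 4 * (p * a))
        ≡⟨ cong (λ x → n + x) (solve 1 (λ x → con 4 :* x :+ con 4 :* x := con 8 :* x) refl (p * a)) ⟩
      n + 8 * (p * a)
        ≤⟨ +-monoʳ-≤ n 8pa≤n ⟩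
      n + n
        ≡⟨ cong (λ x → n + x) (+-identityʳ n) ⟨
      2 * n ∎)

    -- It reduces to 32(1+a)² ≤ 50a², which is an equality at `a = 4`.
    nL≤ : n * (4 * c) ≤ 50 * (a * a)
    nL≤ = begin
      n * (4 * c)
        ≡⟨ solve 2 (λ n c → n :* (con 4 :* c) := con 4 :* (n :* c)) refl n c ⟩
      4 * (n * c)
        ≤⟨ *-monoʳ-≤ 4 (<⇒≤ nc<8[1+a]²) ⟩
      4 * (8 * (suc a * suc a))
        ≡⟨ cong (λ a → 4 * (8 * (suc a * suc a))) a≡ ⟨
      4 * (8 * ((5 + a′) * (5 + a′)))
        ≤⟨ m≤m+n _ (80 * a′ + 18 * (a′ * a′)) ⟩
      4 * (8 * ((5 + a′) * (5 + a′))) + (80 * a′ + 18 * (a′ * a′))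
        ≡⟨ solve 1 (λ a → con 4 :* (con 8 :* ((con 5 :+ a) :* (con 5 :+ a))) :+ (con 80 :* a :+ con 18 :* (a :* a))
             := con 50 :* ((con 4 :+ a) :* (con 4 :+ a))) refl a′ ⟩
      50 * ((4 + a′) * (4 + a′))
        ≡⟨ cong (λ a → 50 * (a * a)) a≡ ⟩
      50 * (a * a) ∎

  parameters : Parameters n
  parameters = record
    { a = a ; d = 2 * (t * a) ; t = t ; c = c ; L = 4 * c
    ; n≤2^L = ≤-trans (proj₂ (proj₂ bracketed)) (≤-reflexive (^-*-assoc 2 4 c))
    ; nL≤50a² = nL≤ ; fits = fits′ ; halving = n≤1+n _ ; enough = a≤ct }

module Small {n : ℕ} (n>3 : 3 < n) (hi : n ≤ 16 ^ 3) where
  open ≤-Reasoning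
  open ℕ-Solver

  private
    largest = greatest-spec (λ a → a + (a + (a * a + a)) ≤? n) n z≤n λ {a} h → ≤-trans (m≤m+n a _) h
    a = proj₁ largest
    n<next = ≰⇒> (proj₂ (proj₂ largest))
    at-least : ∀ {m} → m + (m + (m * m + m)) ≤ n → m ≤ a
    at-least {m} h = ≮⇒≥ λ a<m → <⇒≱ n<next (≤-trans
      (+-mono-≤ a<m (+-mono-≤ a<m (+-mono-≤ (*-mono-≤ a<m a<m) a<m))) h)

  parameters : ∃[ a ] ∃[ L ] (n ≤ 2 ^ L × n * L ≤ 50 * (a * a) × a + (a + (a * a + a)) ≤ n)
  parameters with n ≤? 32
  -- Maximality gives n ≤ a² + 5a + 3. With `L = 5` it is enough that `1 ≤ a`, which holds by 4 ≤ n;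
  -- `L = 12` would fail for `a = 1` and `n = 9`.
  ... | yes n≤32 = a , 5 , n≤32 , (begin
    n * 5
      ≤⟨ *-monoˡ-≤ 5 (≤-pred (subst (λ a → n < suc a + (suc a + (suc a * suc a + suc a))) a≡ n<next)) ⟩
    (1 + a′ + (2 + a′ + ((2 + a′) * (2 + a′) + (2 + a′)))) * 5
      ≤⟨ m≤m+n _ (5 + 65 * a′ + 45 * (a′ * a′)) ⟩
    (1 + a′ + (2 + a′ + ((2 + a′) * (2 + a′) + (2 + a′)))) * 5 + (5 + 65 * a′ + 45 * (a′ * a′))
      ≡⟨ solve 1 (λ a → (con 1 :+ a :+ (con 2 :+ a :+ ((con 2 :+ a) :* (con 2 :+ a) :+ (con 2 :+ a)))) :* con 5
             :+ (con 5 :+ con 65 :* a :+ con 45 :* (a :* a))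
           := con 50 :* ((con 1 :+ a) :* (con 1 :+ a))) refl a′ ⟩
    50 * ((1 + a′) * (1 + a′))
      ≡⟨ cong (λ a → 50 * (a * a)) (sym a≡) ⟩
    50 * (a * a) ∎) , proj₁ (proj₂ largest)
    where
    a′ = a ∸ 1
    a≡ : a ≡ 1 + a′
    a≡ = sym (m+[n∸m]≡n (at-least {1} n>3))
  -- Now n > 28 = 4² + 3·4 gives `4 ≤ a`, enough for `L = 12`, where 2^12 = 16^3.
  ... | no n≰32 = a , 12 , ≤-trans hi (≤-reflexive (^-*-assoc 2 4 3)) , (begin
    n * 12
      ≤⟨ *-monoˡ-≤ 12 (≤-pred (subst (λ a → n < suc a + (suc a + (suc a * suc a + suc a))) a≡ n<next)) ⟩
    (4 + a′ + (5 + a′ + ((5 + a′) * (5 + a′) + (5 + a′)))) * 12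
      ≤⟨ m≤m+n _ (332 + 244 * a′ + 38 * (a′ * a′)) ⟩
    (4 + a′ + (5 + a′ + ((5 + a′) * (5 + a′) + (5 + a′)))) * 12 + (332 + 244 * a′ + 38 * (a′ * a′))
      ≡⟨ solve 1 (λ a → (con 4 :+ a :+ (con 5 :+ a :+ ((con 5 :+ a) :* (con 5 :+ a) :+ (con 5 :+ a)))) :* con 12
             :+ (con 332 :+ con 244 :* a :+ con 38 :* (a :* a))
           := con 50 :* ((con 4 :+ a) :* (con 4 :+ a))) refl a′ ⟩
    50 * ((4 + a′) * (4 + a′))
      ≡⟨ cong (λ a → 50 * (a * a)) (sym a≡) ⟩
    50 * (a * a) ∎) , proj₁ (proj₂ largest)
    where
    a′ = a ∸ 4
    a≡ : a ≡ 4 + a′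
    a≡ = sym (m+[n∸m]≡n (at-least {4} (≤-trans (m≤m+n 28 4) (<⇒≤ (≰⇒> n≰32)))))

-- Real estimates

harmonic≥0 : ∀ a l → 0ℚ ℚ.≤ harmonic a l
harmonic≥0 a zero    = ℚ.≤-refl
harmonic≥0 a (suc l) = ℚ.+-mono-≤ (harmonic≥0 a l) (frac≥0 1 (a + l))

harmonic≤1 : ∀ a l → l ≤ a → harmonic a l ℚ.≤ 1ℚ
harmonic≤1 a l l≤a = ℚ.≤-trans (harmonic-≤ a l) (ℚ.≤-trans (ℚ.≤-reflexive (frac-* l 0 1 a))
  (frac-≤ (l * 1) (a + 0 * suc a) 1 0
    (≤-trans (≤-reflexive (trans (*-identityʳ (l * 1)) (*-identityʳ l)))
      (≤-trans l≤a (≤-trans (n≤1+n a)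
        (≤-reflexive (trans (cong suc (sym (+-identityʳ a))) (sym (*-identityˡ _)))))))))

-- Doubling the endpoint increases the logarithm by ∫ dt/t over [x, 2x], at most 1.
harmonic≤log₂ : ∀ M L l → suc l ≤ 2 ^ L → harmonic M (l * M) ℚ.≤ + L / 1
harmonic≤log₂ M zero zero _ = ℚ.≤-refl
harmonic≤log₂ M zero (suc l) (s≤s ())
harmonic≤log₂ M (suc L) l h with 2 ^ L in eq
... | zero = contradiction h λ ()
-- The first `q * M` terms are the sum for the endpoint `2 ^ L = suc q`. The others, if any, reach
-- at most to twice that endpoint.
... | suc q with ≤-total l q
...   | inj₁ l≤q = ℚ.≤-trans (harmonic≤log₂ M L l (subst (suc l ≤_) (sym eq) (s≤s l≤q)))
        (frac-≤ L 0 (suc L) 0 (*-monoˡ-≤ 1 (n≤1+n L)))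
...   | inj₂ q≤l = begin
  harmonic M (l * M)
    ≡⟨ cong (harmonic M) (trans (cong (_* M) (sym (m+[n∸m]≡n q≤l))) (*-distribʳ-+ M q r)) ⟩
  harmonic M (q * M + r * M)
    ≡⟨ harmonic-++ M (q * M) (r * M) ⟩
  harmonic M (q * M) ℚ.+ harmonic (M + q * M) (r * M)
    ≤⟨ ℚ.+-mono-≤ (harmonic≤log₂ M L q (≤-reflexive (sym eq)))
                  (harmonic≤1 (suc q * M) (r * M) (*-monoˡ-≤ M r≤)) ⟩
  (+ L / 1) ℚ.+ 1ℚ
    ≡⟨ trans (frac-+ L 1 0) (cong (λ t → + t / 1) (+-comm L 1)) ⟩
  + suc L / 1 ∎
  where
  open ℚ.≤-Reasoning
  r = l ∸ q
  r≤ : r ≤ suc q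
  r≤ = ≤-trans (∸-monoˡ-≤ q (≤-pred h)) (≤-reflexive (trans (m+n∸m≡n q _) (+-identityʳ (suc q))))

κ : ℚ
κ = (+ 417 / 1000) ÷ (+ 3 / 1)

κ≥0 : 0ℚ ℚ.≤ κ
κ≥0 = toWitness {a? = 0ℚ ℚ.≤? κ} _

-- `κ` is 0.139, and 50 · 0.139² = 0.96605.
50κ²≤1 : κ ℚ.* κ ℚ.* (+ 50 / 1) ℚ.≤ 1ℚ
50κ²≤1 = toWitness {a? = κ ℚ.* κ ℚ.* (+ 50 / 1) ℚ.≤? 1ℚ} _

fromℕ-* : ∀ a b → (+ a / 1) ℚ.* (+ b / 1) ≡ + (a * b) / 1
fromℕ-* a b = frac-* a 0 b 0

-- This holds at every index and not only in the limit, because each Riemann sum is at most `L`.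
-- Squared, the left side is at most κ²nL ≤ 50κ²a² ≤ a².
κ√≤ : ∀ {n L a} → 0 < n → n ≤ 2 ^ L → n * L ≤ 50 * (a * a) →
  ∀ m → κ ℚ.* approx (√ (fromℕ n *ᴿ log n)) m ℚ.≤ + a / 1
κ√≤ {n@(suc n-1)} {L} {a} _ n≤2^L nL≤50a² m = sq-cancel (frac≥0 a 0) (begin
  κ ℚ.* s ℚ.* (κ ℚ.* s)
    ≡⟨ solve 2 (λ k s → k :* s :* (k :* s) := k :* k :* (s :* s)) refl κ s ⟩
  κ ℚ.* κ ℚ.* (s ℚ.* s)
    ≤⟨ ℚ.*-monoˡ-≤-nonNeg (κ ℚ.* κ) {{ℚ.nonNegative (prod≥0 κ≥0 κ≥0)}} s²≤ ⟩
  κ ℚ.* κ ℚ.* (+ (50 * (a * a)) / 1)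
    ≡⟨ cong (κ ℚ.* κ ℚ.*_) (fromℕ-* 50 (a * a)) ⟨
  κ ℚ.* κ ℚ.* ((+ 50 / 1) ℚ.* (+ (a * a) / 1))
    ≡⟨ ℚ.*-assoc (κ ℚ.* κ) (+ 50 / 1) (+ (a * a) / 1) ⟨
  κ ℚ.* κ ℚ.* (+ 50 / 1) ℚ.* (+ (a * a) / 1)
    ≤⟨ ℚ.*-monoʳ-≤-nonNeg (+ (a * a) / 1) {{ℚ.nonNegative (frac≥0 (a * a) 0)}} 50κ²≤1 ⟩
  1ℚ ℚ.* (+ (a * a) / 1)
    ≡⟨ trans (ℚ.*-identityˡ _) (sym (fromℕ-* a a)) ⟩
  (+ a / 1) ℚ.* (+ a / 1) ∎)
  where
  open ℚ.≤-Reasoning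
  open ℚ-Solver
  q = (+ n / 1) ℚ.* harmonic (suc m) (n-1 * suc m)
  s = sqrt-approx q m
  s²≤ : s ℚ.* s ℚ.≤ + (50 * (a * a)) / 1
  s²≤ = ℚ.≤-trans (sqrt-lower q m) (ℚ.⊔-lub (begin
    q
      ≤⟨ ℚ.*-monoˡ-≤-nonNeg (+ n / 1) {{ℚ.nonNegative (frac≥0 n 0)}} (harmonic≤log₂ (suc m) L n-1 n≤2^L) ⟩
    (+ n / 1) ℚ.* (+ L / 1)
      ≡⟨ fromℕ-* n L ⟩
    + (n * L) / 1
      ≤⟨ frac-≤ (n * L) 0 (50 * (a * a)) 0 (*-monoˡ-≤ 1 nL≤50a²) ⟩
    + (50 * (a * a)) / 1 ∎) (frac≥0 (50 * (a * a)) 0))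

pointwise⇒≤ᴿ : ∀ {x y} → (∀ n → approx x n ℚ.≤ approx y n) → x ≤ᴿ y
pointwise⇒≤ᴿ {x} {y} h δ δ>0 = 0 , λ n _ → ℚ.≤-trans (h n)
  (subst (ℚ._≤ approx y n ℚ.+ δ) (ℚ.+-identityʳ (approx y n)) (ℚ.+-monoʳ-≤ (approx y n) (ℚ.<⇒≤ δ>0)))

≤-difference : ∀ k m n → k + m ≤ n → + k / 1 ℚ.≤ (+ n / 1) ℚ.- (+ m / 1)
≤-difference k m n h = begin
  + k / 1
    ≡⟨ solve 2 (λ k m → k := k :+ m :+ :- m) refl (+ k / 1) (+ m / 1) ⟩
  (+ k / 1) ℚ.+ (+ m / 1) ℚ.- (+ m / 1)
    ≡⟨ cong (ℚ._- (+ m / 1)) (frac-+ k m 0) ⟩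
  (+ (k + m) / 1) ℚ.- (+ m / 1)
    ≤⟨ ℚ.+-monoˡ-≤ (ℚ.- (+ m / 1)) (frac-≤ (k + m) 0 n 0 (*-monoˡ-≤ 1 h)) ⟩
  (+ n / 1) ℚ.- (+ m / 1) ∎
  where
  open ℚ.≤-Reasoning
  open ℚ-Solver

-- Monochromatic components

module _ {n : ℕ} (H : Hypergraph n) where
  open Hypergraph H

  module _ {r : ℕ} (X : Fin r → Subset n) (color : Fin size → Fin r)
           (misses : ∀ j → Empty (edge j ∩ X (color j))) where

    coloring : Coloring r H
    coloring = Vec.tabulate color

    -- A nonempty path from `x` would begin with an edge of color `i` through a vertex of `X i`,
    -- which `misses` forbids.
    component-trivial : ∀ i K → IsComponent (colorClass H coloring i) K →
      ∀ {x} → x Subset.∈ vertices K → x Subset.∈ X i → vertices K Subset.⊆ Subset.⁅ x ⁆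
    component-trivial i K ((_ , K⊆) , (_ , connected) , _) {x} x∈K x∈X {y} y∈K
      with connected x x∈K y y∈K
    ... | ε = Subset.x∈⁅x⁆ x
    ... | (_ , j , j∈K , x∈j , _) ◅ _ = contradiction
      (x , Subset.x∈p∩q⁺ (x∈j , subst (λ i → x Subset.∈ X i) (sym color≡) x∈X)) (misses j)
      where
      color≡ : color j ≡ i
      color≡ = trans (sym (Vec.lookup∘tabulate color j))
        (∈-tabulate⁻ (λ j → Vec.lookup coloring j Fin.≟ i) (K⊆ j∈K))

    -- A component disjoint from `X i` leaves room for its `a` vertices; otherwise it is a single
    -- vertex, and `a < n` suffices.
    component-card : ∀ {a} → a < n → (∀ i → card (X i) ≡ a) → ∀ K →
      MonochromaticComponent H coloring K → card (vertices K) + a ≤ n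
    component-card {a} a<n cardX K (i , comp) with Subset.nonempty? (vertices K ∩ X i)
    ... | no empty = disjoint-card (vertices K) (X i) empty (cardX i)
    ... | yes (x , x∈) with x∈K , x∈X ← Subset.x∈p∩q⁻ (vertices K) (X i) x∈ = ≤-trans
      (+-monoˡ-≤ a (≤-trans (Subset.p⊆q⇒∣p∣≤∣q∣ (component-trivial i K comp x∈K x∈X))
        (≤-reflexive (Subset.∣⁅x⁆∣≡1 x)))) a<n

  tripleOfSize-0 : TripleOfSize H 0
  tripleOfSize-0 = Subset.⊥ , Subset.⊥ , Subset.⊥ , (|⊥| , |⊥| , |⊥|) , (empty , empty , empty) ,
    λ j → inj₁ λ (x , x∈) → Subset.∉⊥ (proj₂ (Subset.x∈p∩q⁻ (edge j) Subset.⊥ x∈))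
    where
    |⊥| = Subset.∣⊥∣≡0 n
    empty : Empty (Subset.⊥ ∩ Subset.⊥)
    empty (x , x∈) = Subset.∉⊥ (proj₁ (Subset.x∈p∩q⁻ Subset.⊥ Subset.⊥ x∈))

  tripleOfSize-2* : ∀ {a} → TripleOfSize H a → a + a ≤ n
  tripleOfSize-2* (X₁ , X₂ , _ , (c₁ , c₂ , _) , (d , _) , _) =
    subst (λ x → x + _ ≤ n) c₁ (disjoint-card X₁ X₂ d c₂)

  tripleOfSize⇒mc : ∀ {a} → 0 < n → TripleOfSize H a → mc 3 H + a ≤ n
  tripleOfSize⇒mc {a} 0<n tr@(X₁ , X₂ , X₃ , (c₁ , c₂ , c₃) , _ , miss) =
    ≤-trans (+-monoˡ-≤ a (greatest-least (forcesComponent? H 3) n bound))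
      (≤-reflexive (m∸n+n≡m (<⇒≤ a<n)))
    where
    a<n : a < n
    -- If `n ≤ a`, then a + n ≤ a + a ≤ n ≤ a, contradicting `0 < n`.
    a<n = ≰⇒> λ n≤a → <⇒≱ 0<n (+-cancelˡ-≤ a n 0
      (≤-trans (+-monoʳ-≤ a n≤a) (≤-trans (tripleOfSize-2* tr)
        (≤-trans n≤a (≤-reflexive (sym (+-identityʳ a)))))))
    X : Fin 3 → Subset n
    X zero             = X₁
    X (suc zero)       = X₂
    X (suc (suc zero)) = X₃
    cardX : ∀ i → card (X i) ≡ a
    cardX zero             = c₁
    cardX (suc zero)       = c₂
    cardX (suc (suc zero)) = c₃
    missed : ∀ j → ∃[ i ] Empty (edge j ∩ X i)
    missed j with miss j
    ... | inj₁ e        = zero , e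
    ... | inj₂ (inj₁ e) = suc zero , e
    ... | inj₂ (inj₂ e) = suc (suc zero) , e
    bound : ∀ {m} → ForcesComponent H 3 m → m ≤ n ∸ a
    bound {m} forces
      with K , comp , m≤ ← forces (coloring X (proj₁ ∘ missed) (proj₂ ∘ missed)) =
      ≤-trans m≤ (m+n≤o⇒m≤o∸n (card (vertices K))
        (component-card X (proj₁ ∘ missed) (proj₂ ∘ missed) a<n cardX K comp))

-- Both ranges of n combined, and the theorem

LargeTriple : {n : ℕ} → Hypergraph n → Set
LargeTriple {n} H = ∃[ a ] ∃[ L ] (n ≤ 2 ^ L × n * L ≤ 50 * (a * a) × TripleOfSize H a)

largeTriple : ∀ {n} → n > 3 → (H : Hypergraph n) → SteinerTripleSystem H → LargeTriple H
largeTriple {n} n>3 H sts = fromDec (n ≤? 16 ^ 3)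
  where
  fromSmall : ∃[ a ] ∃[ L ] (n ≤ 2 ^ L × n * L ≤ 50 * (a * a) × a + (a + (a * a + a)) ≤ n) →
    LargeTriple H
  fromSmall (a , L , n≤2^L , nL≤50a² , fits) = a , L , n≤2^L , nL≤50a² , direct H sts a fits
  fromLarge : Parameters n → LargeTriple H
  fromLarge p = a , L , n≤2^L , nL≤50a² , greedy H sts a d t c fits halving enough
    where open Parameters p
  fromDec : Dec (n ≤ 16 ^ 3) → LargeTriple H
  fromDec (yes small) = fromSmall (Small.parameters n>3 small)
  fromDec (no  large) = fromLarge (Large.parameters (≰⇒> large))

κ√≤α₃* : ∀ {n} → 0 < n → (H : Hypergraph n) → LargeTriple H →
  ∀ m → κ ℚ.* approx (√ (fromℕ n *ᴿ log n)) m ℚ.≤ + α₃* H / 1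
κ√≤α₃* {n} 0<n H (a , L , n≤2^L , nL≤50a² , triple) m =
  ℚ.≤-trans (κ√≤ {n} {L} {a} 0<n n≤2^L nL≤50a² m) (frac-≤ a 0 (α₃* H) 0 (*-monoˡ-≤ 1 a≤α))
  where
  a≤α : a ≤ α₃* H
  a≤α = greatest-upper (tripleOfSize? H) (≤-trans (m≤m+n a a) (tripleOfSize-2* H triple)) triple

corollary2p1 : ∀ (n : ℕ) → n > 3 → (S : Hypergraph n) → SteinerTripleSystem S →
    (fromℕ (mc 3 S) ≤ᴿ fromℕ n -ᴿ fromℕ (α₃* S)) ×
    (fromℕ n -ᴿ fromℕ (α₃* S) ≤ᴿ
    fromℕ n -ᴿ fromℚ ((+ 417 / 1000) ÷ (+ 3 / 1)) *ᴿ √ (fromℕ n *ᴿ log n))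
corollary2p1 n n>3 S sts =
  pointwise⇒≤ᴿ {fromℕ (mc 3 S)} {fromℕ n -ᴿ fromℕ (α₃* S)}
    -- The value `α₃* S` is attained, since the search always has the empty triple to fall back on.
    (λ _ → ≤-difference (mc 3 S) (α₃* S) n (tripleOfSize⇒mc S 0<n
      (greatest-satisfies (tripleOfSize? S) n (tripleOfSize-0 S)))) ,
  pointwise⇒≤ᴿ {fromℕ n -ᴿ fromℕ (α₃* S)} {fromℕ n -ᴿ fromℚ κ *ᴿ √ (fromℕ n *ᴿ log n)}
    (λ m → ℚ.+-monoʳ-≤ (+ n / 1)
      (ℚ.neg-antimono-≤ (κ√≤α₃* 0<n S (largeTriple n>3 S sts) m)))
  where
  0<n : 0 < n
  0<n = ≤-trans (s≤s z≤n) n>3
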